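{- The modal logic $\mathsf{S5}$ has the local coequivalence separation property (LCoSP), and so does its infinitary extension $\mathsf{S5}^\infty$.
   Context: **Formulas and consequence.** For $\mathsf{S5}$: formulas of basic modal logic; $\overline p,\overline q,\overline r$ denote finite tuples of distinct variables (different tuples disjoint), and $\overline p_1,\overline p_2,\dots$ are disjoint copies of $\overline p$ (with $p_i$ the copy of $p\in\overline p$ in $\overline p_i$). $\phi(\overline p)$ means the variables of $\phi$ are among $\overline p$. The relation $\alpha\vdash\beta$ is global consequence: $\beta$ is derivable from $\alpha$ and the theorems of $\mathsf{S5}$ using Modus Ponens and Necessitation (uniform substitution only applied to axioms); equivalently, in every Kripke model based on a finite cluster (a finite nonempty set with the total relation), if $\alpha$ is true at all points then $\beta$ is true at all points. For $\mathsf{S5}^\infty$ (the infinitary extension of $\mathsf{S5}$ whose algebraic models are the profinite $\mathsf{S5}$-algebras, dually the locally finite $\mathsf{S5}$-frames, i.e. sets with an equivalence relation all of whose classes are finite): formulas are built from variables using $\neg$, $\Box$ and conjunctions of arbitrary sets of formulas; $\overline p,\overline q,\overline r$ are arbitrary sets (tuples) of variables; and $\alpha\vdash\beta$ means that in every Kripke model based on a locally finite $\mathsf{S5}$-frame, if $\alpha$ is true at all points then $\beta$ is true at all points. **LCoSP**, for $L=\mathsf{S5}$ or $L=\mathsf{S5}^\infty$, writing $\vdash_L$ for the corresponding consequence. For $\alpha(\overline p)$ let $\mathsf{Ext}(\alpha)=\{\beta(\overline p,\overline q):\beta\vdash_L\alpha\}$. Let $\beta(\overline p,\overline q)\in\mathsf{Ext}(\alpha)$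 and $\gamma(\overline p,\overline q,\overline r)\in\mathsf{Ext}(\beta)$. A sequence $\overline\xi=(\xi_r(\overline p,\overline q_1,\overline q_2,\overline r))_{r\in\overline r}$ of formulas is a sequence of *local transition terms* for $\gamma$ if: - ($\gamma$-compatibility) $\gamma(\overline p,\overline q_1,\overline r)\wedge\beta(\overline p,\overline q_2)\vdash_L\gamma(\overline p,\overline q_2,\overline\xi)$; - (Identity) for each $r\in\overline r$, $\gamma(\overline p,\overline q,\overline r)\vdash_L r\leftrightarrow\xi_r(\overline p,\overline q,\overline q,\overline r)$; - (Cocycle) for each $r\in\overline r$, $\gamma(\overline p,\overline q_1,\overline r)\wedge\beta(\overline p,\overline q_2)\wedge\beta(\overline p,\overline q_3)\vdash_L\xi_r(\overline p,\overline q_1,\overline q_3,\overline r)\leftrightarrow\xi_r(\overline p,\overline q_2,\overline q_3,\overline\xi(\overline p,\overline q_1,\overline q_2,\overline r))$. The associated *local coequivalence relation* is $$\rho_{\gamma,\overline\xi}=\gamma(\overline p_1,\overline q_1,\overline r_1)\wedge\gamma(\overline p_2,\overline q_2,\overline r_2)\wedge\bigwedge_{p\in\overline p}(p_1\leftrightarrow p_2)\wedge\bigwedge_{r\in\overline r}(\xi_r(\overline p_1,\overline q_1,\overline q_2,\overline r_1)\leftrightarrow r_2).$$ It *separates variables* if there is a family of formulas $(\psi_i)_{i\in I}$ in the variables $\overline p,\overline q,\overline r$ ($I$ finite for $\mathsf{S5}$, $I$ any set for $\mathsf{S5}^\infty$) such that $\rho_{\gamma,\overline\xi}$ is $\vdash_L$-interderivable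 with $$\gamma(\overline p_1,\overline q_1,\overline r_1)\wedge\gamma(\overline p_2,\overline q_2,\overline r_2)\wedge\bigwedge_{i\in I}\big(\psi_i(\overline p_1,\overline q_1,\overline r_1)\leftrightarrow\psi_i(\overline p_2,\overline q_2,\overline r_2)\big).$$ $L$ has the *LCoSP* if for all $\alpha$, $\beta\in\mathsf{Ext}(\alpha)$, $\gamma\in\mathsf{Ext}(\beta)$ and all local transition terms $\overline\xi$ for $\gamma$, the relation $\rho_{\gamma,\overline\xi}$ separates variables. -}

module Defs where

open import Level using (Level; Lift; _⊔_; 0ℓ) renaming (suc to lsuc)
open import Data.Bool using (Bool; true; false)
open import Data.Fin using (Fin; zero; suc)
open import Data.List using (List)
open import Data.List.Membership.Propositional using (_∈_)
open import Data.Nat using (ℕ; zero; suc)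
open import Data.Product using (Σ-syntax; ∃-syntax; _×_)
open import Data.Sum using (_⊎_; inj₁; inj₂; [_,_]′)
open import Function using (_∘_)
open import Function.Bundles using (_⇔_)
open import Relation.Binary using (Rel; IsEquivalence)
open import Relation.Binary.PropositionalEquality using (_≡_)
open import Relation.Nullary using (¬_)

-- The data of a logic that the LCoSP refers to.  `Tuple` lists the index
-- sets allowed both for tuples of variables and for the conjunctions ⋀: the
-- finite sets Fin n for S5, all sets for S5∞.  Formulas are indexed by the
-- type of variables that may occur in them, so φ(p̄) is φ : Form ∣ p̄ ∣, and
-- disjoint tuples (in particular disjoint copies) are summands of a
-- disjoint union.

record Logic (t ℓ f c : Level) : Set (lsuc (t ⊔ ℓ ⊔ f ⊔ c)) where
  infix  2 _⊢_
  infixr 5 _∧_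
  infix  4 _↔_
  infixl 8 _[_]
  field
    Tuple : Set t
    ∣_∣   : Tuple → Set ℓ
    Form  : Set ℓ → Set f
    var   : {X : Set ℓ} → X → Form X
    _∧_   : {X : Set ℓ} → Form X → Form X → Form X
    _↔_   : {X : Set ℓ} → Form X → Form X → Form X
    ⋀     : {X : Set ℓ} (I : Tuple) → (∣ I ∣ → Form X) → Form X
    _[_]  : {X Y : Set ℓ} → Form X → (X → Form Y) → Form Y
    _⊢_   : {X : Set ℓ} → Form X → Form X → Set c

------------------------------------------------------------------------
-- S5

module S5-logic where

  infixr 4 _⇒_
  infixr 5 _∧_
  infix  4 _↔_
  infixl 8 _[_]
  infix  2 _⊢_

  data Form (X : Set) : Set where
    var : X → Form X
    ⊥′  : Form X
    _⇒_ : Form X → Form X → Form X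
    □   : Form X → Form X

  ¬′_ : {X : Set} → Form X → Form X
  ¬′ φ = φ ⇒ ⊥′

  _∧_ _↔_ : {X : Set} → Form X → Form X → Form X
  φ ∧ ψ = ¬′ (φ ⇒ ¬′ ψ)
  φ ↔ ψ = (φ ⇒ ψ) ∧ (ψ ⇒ φ)

  ⋀ : {X : Set} (n : ℕ) → (Fin n → Form X) → Form X
  ⋀ zero    φ = ¬′ ⊥′
  ⋀ (suc n) φ = φ zero ∧ ⋀ n (φ ∘ suc)

  _[_] : {X Y : Set} → Form X → (X → Form Y) → Form Y
  var x   [ σ ] = σ x
  ⊥′      [ σ ] = ⊥′
  (φ ⇒ ψ) [ σ ] = φ [ σ ] ⇒ ψ [ σ ]
  □ φ     [ σ ] = □ (φ [ σ ])

  data Axiom {X : Set} : Form X → Set where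
    ax-weak : ∀ φ ψ   → Axiom (φ ⇒ ψ ⇒ φ)
    ax-dist : ∀ φ ψ χ → Axiom ((φ ⇒ ψ ⇒ χ) ⇒ (φ ⇒ ψ) ⇒ φ ⇒ χ)
    ax-dne  : ∀ φ     → Axiom (¬′ ¬′ φ ⇒ φ)
    ax-K    : ∀ φ ψ   → Axiom (□ (φ ⇒ ψ) ⇒ □ φ ⇒ □ ψ)
    ax-T    : ∀ φ     → Axiom (□ φ ⇒ φ)
    ax-4    : ∀ φ     → Axiom (□ φ ⇒ □ (□ φ))
    ax-5    : ∀ φ     → Axiom (¬′ □ φ ⇒ □ (¬′ □ φ))

  -- Global consequence: necessitation also applies to what depends on α.
  data _⊢_ {X : Set} (α : Form X) : Form X → Set where
    hyp   : α ⊢ α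
    axiom : ∀ {φ} → Axiom φ → α ⊢ φ
    mp    : ∀ {φ ψ} → α ⊢ φ ⇒ ψ → α ⊢ φ → α ⊢ ψ
    nec   : ∀ {φ} → α ⊢ φ → α ⊢ □ φ

S5 : Logic 0ℓ 0ℓ 0ℓ 0ℓ
S5 = record { Tuple = ℕ ; ∣_∣ = Fin ; S5-logic }

------------------------------------------------------------------------
-- S5∞, for sets in the universe Set ℓ

module S5∞-logic (ℓ : Level) where

  infixr 5 _∧_
  infix  4 _↔_
  infixl 8 _[_]
  infix  2 _⊢_

  data Form (X : Set ℓ) : Set (lsuc ℓ) where
    var : X → Form X
    ¬′_ : Form X → Form X
    □   : Form X → Form X
    ⋀   : (I : Set ℓ) → (I → Form X) → Form X

  _∧_ _↔_ : {X : Set ℓ} → Form X → Form X → Form X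
  φ ∧ ψ = ⋀ (Lift ℓ Bool) λ where
    (Level.lift true)  → φ
    (Level.lift false) → ψ
  φ ↔ ψ = ¬′ (φ ∧ ¬′ ψ) ∧ ¬′ (ψ ∧ ¬′ φ)

  _[_] : {X Y : Set ℓ} → Form X → (X → Form Y) → Form Y
  var x  [ σ ] = σ x
  (¬′ φ) [ σ ] = ¬′ (φ [ σ ])
  □ φ    [ σ ] = □ (φ [ σ ])
  ⋀ I φ  [ σ ] = ⋀ I λ i → φ i [ σ ]

  record LocallyFiniteFrame : Set (lsuc ℓ) where
    infix 4 _~_
    field
      World         : Set ℓ
      _~_           : Rel World ℓ
      isEquivalence : IsEquivalence _~_
      locallyFinite : ∀ w → ∃[ vs ] (∀ v → w ~ v ⇔ v ∈ vs)

  open LocallyFiniteFrame using (World)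

  -- A variable denotes a subset of the frame, given by its characteristic
  -- function.  With ¬, □ and ⋀ as the only connectives, ⊨ is then ¬¬-stable,
  -- so it obeys the classical laws without an excluded-middle assumption.
  Valuation : LocallyFiniteFrame → Set ℓ → Set ℓ
  Valuation F X = World F → X → Bool

  module _ {F : LocallyFiniteFrame} {X : Set ℓ} where

    open LocallyFiniteFrame F using (_~_)

    infix 2 _,_⊨_

    _,_⊨_ : Valuation F X → World F → Form X → Set ℓ
    V , w ⊨ var x = Lift ℓ (V w x ≡ true)
    V , w ⊨ ¬′ φ  = ¬ (V , w ⊨ φ)
    V , w ⊨ □ φ   = ∀ v → w ~ v → V , v ⊨ φ
    V , w ⊨ ⋀ I φ = ∀ i → V , w ⊨ φ i

  _⊢_ : {X : Set ℓ} → Form X → Form X → Set (lsuc ℓ)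
  _⊢_ {X} α β = (F : LocallyFiniteFrame) (V : Valuation F X) →
    (∀ w → _,_⊨_ {F} V w α) → ∀ w → _,_⊨_ {F} V w β

S5∞ : (ℓ : Level) → Logic (lsuc ℓ) ℓ (lsuc ℓ) (lsuc ℓ)
S5∞ ℓ = record
  { Tuple = Set ℓ ; ∣_∣ = λ X → X
  ; Form = Form ; var = var ; _∧_ = _∧_ ; _↔_ = _↔_ ; ⋀ = ⋀ ; _[_] = _[_] ; _⊢_ = _⊢_ }
  where open S5∞-logic ℓ

------------------------------------------------------------------------
-- The local coequivalence separation property

module _ {t ℓ f c : Level} (L : Logic t ℓ f c) where

  open Logic L

  -- Ext B α β: β, which has the further variables B, belongs to Ext(α).
  Ext : {A : Set ℓ} (B : Set ℓ) → Form A → Form (A ⊎ B) → Set c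
  Ext B α β = β ⊢ α [ var ∘ inj₁ ]

  module _ {P Q R : Tuple} where

    Formβ Formγ Formξ : Set f
    Formβ = Form (∣ P ∣ ⊎ ∣ Q ∣)
    Formγ = Form ((∣ P ∣ ⊎ ∣ Q ∣) ⊎ ∣ R ∣)
    Formξ = Form (((∣ P ∣ ⊎ ∣ Q ∣) ⊎ ∣ Q ∣) ⊎ ∣ R ∣)

    module _ {X : Set ℓ} where

      infixl 8 _⟨_,_⟩ _⟨_,_,_⟩ _⟨_,_,_,_⟩

      _⟨_,_⟩ : Formβ → (∣ P ∣ → Form X) → (∣ Q ∣ → Form X) → Form X
      β ⟨ p , q ⟩ = β [ [ p , q ]′ ]

      _⟨_,_,_⟩ : Formγ →
        (∣ P ∣ → Form X) → (∣ Q ∣ → Form X) → (∣ R ∣ → Form X) → Form X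
      γ ⟨ p , q , r ⟩ = γ [ [ [ p , q ]′ , r ]′ ]

      _⟨_,_,_,_⟩ : (∣ R ∣ → Formξ) →
        (∣ P ∣ → Form X) → (∣ Q ∣ → Form X) → (∣ Q ∣ → Form X) → (∣ R ∣ → Form X) →
        ∣ R ∣ → Form X
      (ξ ⟨ p , q₁ , q₂ , r ⟩) x = ξ x [ [ [ [ p , q₁ ]′ , q₂ ]′ , r ]′ ]

    Compatibility : Formβ → Formγ → (∣ R ∣ → Formξ) → Set c
    Compatibility β γ ξ =
      γ ⟨ p , q₁ , r ⟩ ∧ β ⟨ p , q₂ ⟩ ⊢ γ ⟨ p , q₂ , ξ ⟨ p , q₁ , q₂ , r ⟩ ⟩
      where
      X  = ((∣ P ∣ ⊎ ∣ Q ∣) ⊎ ∣ Q ∣) ⊎ ∣ R ∣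
      p  : ∣ P ∣ → Form X
      q₁ q₂ : ∣ Q ∣ → Form X
      r  : ∣ R ∣ → Form X
      p  = var ∘ inj₁ ∘ inj₁ ∘ inj₁
      q₁ = var ∘ inj₁ ∘ inj₁ ∘ inj₂
      q₂ = var ∘ inj₁ ∘ inj₂
      r  = var ∘ inj₂

    Identity : Formγ → (∣ R ∣ → Formξ) → Set (ℓ ⊔ c)
    Identity γ ξ = ∀ x → γ ⊢ r x ↔ (ξ ⟨ p , q , q , r ⟩) x
      where
      X = (∣ P ∣ ⊎ ∣ Q ∣) ⊎ ∣ R ∣
      p : ∣ P ∣ → Form X
      q : ∣ Q ∣ → Form X
      r : ∣ R ∣ → Form X
      p = var ∘ inj₁ ∘ inj₁
      q = var ∘ inj₁ ∘ inj₂
      r = var ∘ inj₂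

    Cocycle : Formβ → Formγ → (∣ R ∣ → Formξ) → Set (ℓ ⊔ c)
    Cocycle β γ ξ = ∀ x →
      γ ⟨ p , q₁ , r ⟩ ∧ β ⟨ p , q₂ ⟩ ∧ β ⟨ p , q₃ ⟩ ⊢
        (ξ ⟨ p , q₁ , q₃ , r ⟩) x ↔ (ξ ⟨ p , q₂ , q₃ , ξ ⟨ p , q₁ , q₂ , r ⟩ ⟩) x
      where
      X  = (((∣ P ∣ ⊎ ∣ Q ∣) ⊎ ∣ Q ∣) ⊎ ∣ Q ∣) ⊎ ∣ R ∣
      p  : ∣ P ∣ → Form X
      q₁ q₂ q₃ : ∣ Q ∣ → Form X
      r  : ∣ R ∣ → Form X
      p  = var ∘ inj₁ ∘ inj₁ ∘ inj₁ ∘ inj₁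
      q₁ = var ∘ inj₁ ∘ inj₁ ∘ inj₁ ∘ inj₂
      q₂ = var ∘ inj₁ ∘ inj₁ ∘ inj₂
      q₃ = var ∘ inj₁ ∘ inj₂
      r  = var ∘ inj₂

    record LocalTransitionTerms (β : Formβ) (γ : Formγ) (ξ : ∣ R ∣ → Formξ) :
        Set (ℓ ⊔ c) where
      field
        compatibility : Compatibility β γ ξ
        identity      : Identity γ ξ
        cocycle       : Cocycle β γ ξ

    -- The variables p̄ᵢ, q̄ᵢ, r̄ᵢ (i = 1, 2) form the i-th summand.
    Two : Set ℓ
    Two = ((∣ P ∣ ⊎ ∣ Q ∣) ⊎ ∣ R ∣) ⊎ ((∣ P ∣ ⊎ ∣ Q ∣) ⊎ ∣ R ∣)

    copy₁ copy₂ : Formγ → Form Two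
    copy₁ φ = φ [ var ∘ inj₁ ]
    copy₂ φ = φ [ var ∘ inj₂ ]

    ρ : Formγ → (∣ R ∣ → Formξ) → Form Two
    ρ γ ξ =
      copy₁ γ ∧ copy₂ γ
        ∧ ⋀ P (λ x → p₁ x ↔ p₂ x)
        ∧ ⋀ R (λ x → (ξ ⟨ p₁ , q₁ , q₂ , r₁ ⟩) x ↔ r₂ x)
      where
      p₁ p₂ : ∣ P ∣ → Form Two
      q₁ q₂ : ∣ Q ∣ → Form Two
      r₁ r₂ : ∣ R ∣ → Form Two
      p₁ = var ∘ inj₁ ∘ inj₁ ∘ inj₁
      q₁ = var ∘ inj₁ ∘ inj₁ ∘ inj₂
      r₁ = var ∘ inj₁ ∘ inj₂
      p₂ = var ∘ inj₂ ∘ inj₁ ∘ inj₁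
      q₂ = var ∘ inj₂ ∘ inj₁ ∘ inj₂
      r₂ = var ∘ inj₂ ∘ inj₂

    SeparatesVariables : Formγ → (∣ R ∣ → Formξ) → Set (t ⊔ ℓ ⊔ f ⊔ c)
    SeparatesVariables γ ξ =
      Σ[ I ∈ Tuple ] Σ[ ψ ∈ (∣ I ∣ → Formγ) ]
        let sep = copy₁ γ ∧ copy₂ γ ∧ ⋀ I (λ i → copy₁ (ψ i) ↔ copy₂ (ψ i))
        in (ρ γ ξ ⊢ sep) × (sep ⊢ ρ γ ξ)

  LCoSP : Set (t ⊔ ℓ ⊔ f ⊔ c)
  LCoSP =
    {P Q R : Tuple}
    (α : Form ∣ P ∣)
    (β : Form (∣ P ∣ ⊎ ∣ Q ∣)) → Ext ∣ Q ∣ α β →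
    (γ : Form ((∣ P ∣ ⊎ ∣ Q ∣) ⊎ ∣ R ∣)) → Ext ∣ R ∣ β γ →
    (ξ : ∣ R ∣ → Form (((∣ P ∣ ⊎ ∣ Q ∣) ⊎ ∣ Q ∣) ⊎ ∣ R ∣)) →
    LocalTransitionTerms {P} {Q} {R} β γ ξ →
    SeparatesVariables {P} {Q} {R} γ ξ

module Submission where

-- A model of γ on a finite cluster C is a triple (p, q, r) of maps on C.  Given
-- a finite cluster T interpreting p̄, q̄, whose p̄-types are those of C, form the
-- fibre product C ×ₚ T.  It carries two interpretations of q̄, namely q from C
-- and q′ from T, so ξ(p, q, q′, r) makes sense on it, and by the cocycle
-- condition this value depends on (p, q, r) only up to ρ.  It is expressible
-- on C by relativising □ to pairs of points with the same p̄-type; these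
-- formulas, for all T, are the separating ψᵢ (together with the variables p̄).
-- They suffice: if (p, q₁, r₁) and (p, q₂, r₂) agree on them, take T = (C, q₁).
-- On the fibre product ξ(p, q₁, q′, r₁) = ξ(p, q₂, q′, r₂), hence
--   ξ(p, q₁, q₂, r₁) = ξ(p, q′, q₂, ξ(p, q₁, q′, r₁))
--                    = ξ(p, q′, q₂, ξ(p, q₂, q′, r₂)) = ξ(p, q₂, q₂, r₂) = r₂.

open import Level using (Level; Lift; lift; lower; _⊔_; 0ℓ) renaming (suc to lsuc)
open import Data.Bool using (Bool; true; false)
import Data.Bool as Bool
open import Data.Bool.Properties using (¬-not; not-¬)
open import Data.Empty using (⊥)
open import Data.Fin using (Fin; zero; suc; finToFun; funToFin; _≟_)
open import Data.Fin.Properties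
  using (sequence; all?; any?; ¬∀⟶∃¬; 2↔Bool; +↔⊎; *↔×; finToFun-funToFin)
open import Data.List using (List; length; lookup; filter; allFin; cartesianProduct)
import Data.List as List
open import Data.List.Membership.Propositional using (_∈_)
open import Data.List.Membership.Propositional.Properties
  using (∈-filter⁺; ∈-filter⁻; ∈-lookup; ∈-allFin; ∈-cartesianProduct⁺; ∈-map⁺)
open import Data.List.Relation.Unary.Any using (index)
open import Data.List.Relation.Unary.Any.Properties using (lookup-index)
open import Data.Nat using (ℕ; zero; suc; _+_; _*_; _^_)
open import Data.Product using (Σ-syntax; ∃-syntax; _×_; _,_; proj₁; proj₂)
open import Data.Product.Function.NonDependent.Propositional using (_×-⇔_; _×-↔_)
open import Data.Sum using (_⊎_; inj₁; inj₂; [_,_]′)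
open import Data.Sum.Function.Propositional using (_⊎-↔_)
open import Data.Unit.Polymorphic using (⊤; tt)
open import Effect.Monad using (RawMonad)
open import Function using (_∘_; id)
open import Function.Bundles using (_⇔_; mk⇔; Equivalence; Inverse) renaming (_↔_ to _≅_)
open import Function.Construct.Composition using (equivalence) renaming (inverse to ↔-trans)
open import Function.Construct.Identity using (⇔-id; ↔-id)
open import Function.Construct.Symmetry using (⇔-sym)
open import Relation.Binary using (IsEquivalence)
open import Relation.Binary.PropositionalEquality using (_≡_; refl; sym; trans; cong; subst)
open import Relation.Nullary using (¬_; Dec; yes; no; contradiction; Stable; negated-stable)
open import Relation.Nullary.Decidable using (¬¬-excluded-middle; decidable-stable; _→-dec_; map′)
open import Relation.Nullary.Negation using (¬¬-Monad; ¬¬-map)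
open import Relation.Unary using (Pred; Decidable; _∪_; _⊆_; ｛_｝; ∅)
open import Defs

open Equivalence using (to; from)

-- Equivalences, double negation and finite enumeration.

infixr 4 _⨾_
_⨾_ : ∀ {a b c} {A : Set a} {B : Set b} {C : Set c} → A ⇔ B → B ⇔ C → A ⇔ C
_⨾_ = equivalence

Π-⇔ : ∀ {i a b} {I : Set i} {A : I → Set a} {B : I → Set b} →
      (∀ i → A i ⇔ B i) → (∀ i → A i) ⇔ (∀ i → B i)
Π-⇔ e = mk⇔ (λ f i → to (e i) (f i)) (λ g i → from (e i) (g i))

→-⇔ : ∀ {a b c d} {A : Set a} {B : Set b} {C : Set c} {D : Set d} →
      A ⇔ B → C ⇔ D → (A → C) ⇔ (B → D)
→-⇔ e e′ = mk⇔ (λ f → to e′ ∘ f ∘ from e) (λ g → from e′ ∘ g ∘ to e)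

≡true-ext : ∀ {a b : Bool} → (a ≡ true ⇔ b ≡ true) → a ≡ b
≡true-ext {true}          e = sym (to e refl)
≡true-ext {false} {true}  e = from e refl
≡true-ext {false} {false} e = refl

-- Double negation is an applicative functor, so it can be pulled out of a finite product. This is
-- how finitely many classical choices are made at once.
¬¬-Π : ∀ {a n} {A : Fin n → Set a} → (∀ i → ¬ ¬ A i) → ¬ ¬ (∀ i → A i)
¬¬-Π = sequence (RawMonad.rawApplicative ¬¬-Monad)

enumerateSubset : ∀ {a p} {A : Set a} {P : Pred A p} (xs : List A) →
  (∀ x → x ∈ xs) → Decidable P →
  Σ[ m ∈ ℕ ] Σ[ e ∈ (Fin m → A) ] (∀ d → P (e d)) × (∀ x → P x → ∃[ d ] e d ≡ x)
enumerateSubset xs all P? = length ys , lookup ys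
  , (λ d → proj₂ (∈-filter⁻ P? {xs = xs} (∈-lookup d)))
  , λ x Px → let x∈ys = ∈-filter⁺ P? (all x) Px in index x∈ys , sym (lookup-index x∈ys)
  where ys = filter P? xs

-- Semantics on finite clusters, common to both logics.

module _ {ℓ : Level} where

  infix 4 _≈_
  _≈_ : {X : Set ℓ} → (X → Set ℓ) → (X → Set ℓ) → Set ℓ
  A ≈ B = ∀ x → A x ⇔ B x

  ⟦_⟧ : {W : Set} {X : Set ℓ} → (W → X → Bool) → W → X → Set ℓ
  ⟦ v ⟧ w x = Lift ℓ (v w x ≡ true)

  ⟦⟧-≡ : {X : Set ℓ} {f g : X → Bool} →
         (∀ x → f x ≡ g x) → (λ x → Lift ℓ (f x ≡ true)) ≈ (λ x → Lift ℓ (g x ≡ true))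
  ⟦⟧-≡ f≡g x = mk⇔ (λ (lift e) → lift (trans (sym (f≡g x)) e)) (λ (lift e) → lift (trans (f≡g x) e))

-- Sat evaluates formulas on a set of worlds with the total relation.  Variables
-- may denote arbitrary propositions, since a substituted formula need not have a
-- Boolean truth value constructively; the laws of the connectives are only
-- required for Boolean valuations, where satisfaction is ¬¬-stable.
record ClusterSemantics {t ℓ f c} (L : Logic t ℓ f c) : Set (t ⊔ lsuc ℓ ⊔ f ⊔ c) where
  open Logic L
  field
    Sat : {W : Set} {X : Set ℓ} → (W → X → Set ℓ) → W → Form X → Set ℓ

    sat-bisim : {W W′ : Set} {X : Set ℓ} {V : W → X → Set ℓ} {V′ : W′ → X → Set ℓ} →
      (∀ w → ∃[ w′ ] V w ≈ V′ w′) → (∀ w′ → ∃[ w ] V w ≈ V′ w′) →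
      ∀ {w w′} → V w ≈ V′ w′ → (φ : Form X) → Sat V w φ ⇔ Sat V′ w′ φ
    sat-[]  : {W : Set} {X Y : Set ℓ} {V : W → Y → Set ℓ} {w : W} (φ : Form X) (σ : X → Form Y) →
      Sat V w (φ [ σ ]) ⇔ Sat (λ u x → Sat V u (σ x)) w φ
    sat-var : {W : Set} {X : Set ℓ} {V : W → X → Set ℓ} {w : W} {x : X} →
      Sat V w (var x) ⇔ V w x

    ¬ᶠ_ □ᶠ : {X : Set ℓ} → Form X → Form X
    ⋁ᶠ     : {X : Set ℓ} (k : ℕ) → (Fin k → Form X) → Form X
    -- relativize θ σ φ j evaluates φ at the point (w , j) of the cluster
    -- {(w , j) ∣ w satisfies θ j}, with variables read through σ.
    relativize : {X Y : Set ℓ} {k : ℕ} →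
      (Fin k → Form X) → (Fin k → Y → Form X) → Form Y → Fin k → Form X

    sat-stable : {W : Set} {X : Set ℓ} (v : W → X → Bool) (w : W) (φ : Form X) → Stable (Sat ⟦ v ⟧ w φ)
    sat-¬      : {W : Set} {X : Set ℓ} (v : W → X → Bool) (w : W) (φ : Form X) →
      Sat ⟦ v ⟧ w (¬ᶠ φ) ⇔ (¬ Sat ⟦ v ⟧ w φ)
    sat-□      : {W : Set} {X : Set ℓ} (v : W → X → Bool) (w : W) (φ : Form X) →
      Sat ⟦ v ⟧ w (□ᶠ φ) ⇔ (∀ u → Sat ⟦ v ⟧ u φ)
    sat-∧      : {W : Set} {X : Set ℓ} (v : W → X → Bool) (w : W) (φ ψ : Form X) →
      Sat ⟦ v ⟧ w (φ ∧ ψ) ⇔ (Sat ⟦ v ⟧ w φ × Sat ⟦ v ⟧ w ψ)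
    sat-↔      : {W : Set} {X : Set ℓ} (v : W → X → Bool) (w : W) (φ ψ : Form X) →
      Sat ⟦ v ⟧ w (φ ↔ ψ) ⇔ (Sat ⟦ v ⟧ w φ ⇔ Sat ⟦ v ⟧ w ψ)
    sat-⋀      : {W : Set} {X : Set ℓ} (v : W → X → Bool) (w : W) →
      (I : Tuple) (φ : ∣ I ∣ → Form X) → Sat ⟦ v ⟧ w (⋀ I φ) ⇔ (∀ i → Sat ⟦ v ⟧ w (φ i))
    sat-⋁      : {W : Set} {X : Set ℓ} (v : W → X → Bool) (w : W) →
      (k : ℕ) (φ : Fin k → Form X) → Sat ⟦ v ⟧ w (⋁ᶠ k φ) ⇔ (¬ (∀ j → ¬ Sat ⟦ v ⟧ w (φ j)))
    sat-relativize : {W W′ : Set} {X Y : Set ℓ} {k : ℕ} (v : W → X → Bool)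
      (θ : Fin k → Form X) (σ : Fin k → Y → Form X)
      (π₁ : W′ → W) (π₂ : W′ → Fin k) →
      (∀ d → Sat ⟦ v ⟧ (π₁ d) (θ (π₂ d))) →
      (∀ w j → Sat ⟦ v ⟧ w (θ j) → ∃[ d ] (π₁ d , π₂ d) ≡ (w , j)) →
      (φ : Form Y) (d : W′) →
      Sat ⟦ v ⟧ (π₁ d) (relativize θ σ φ (π₂ d)) ⇔
      Sat (λ e y → Sat ⟦ v ⟧ (π₁ e) (σ (π₂ e) y)) d φ

    sound : {X : Set ℓ} {α β : Form X} → α ⊢ β → ∀ {n} (v : Fin n → X → Bool) →
      (∀ i → Sat ⟦ v ⟧ i α) → ∀ i → Sat ⟦ v ⟧ i β
    -- Asked only for the variables `Two`, which form a finite set in S5; the completeness proof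
    -- there enumerates them.
    complete : (P Q R : Tuple) {α β : Form (Two L {P} {Q} {R})} →
      (∀ {n} (v : Fin n → Two L {P} {Q} {R} → Bool) →
        (∀ i → Sat ⟦ v ⟧ i α) → ∀ i → Sat ⟦ v ⟧ i β) →
      α ⊢ β

    -- The separating formulas are indexed by the variables p̄ and by triples of a
    -- finite cluster model T of p̄, q̄, a point of T and a variable of r̄; decode-model
    -- says that each nonempty finite cluster model occurs up to bisimulation.
    Index  : Tuple → Tuple → Tuple → Tuple
    decode : ∀ P Q R → ∣ Index P Q R ∣ →
      ∣ P ∣ ⊎ (Σ[ k ∈ ℕ ] (Fin k → ∣ P ∣ ⊎ ∣ Q ∣ → Bool) × Fin k) × ∣ R ∣
    decode-var : ∀ P Q R x → ∃[ i ] decode P Q R i ≡ inj₁ x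
    decode-model : ∀ P Q R {n} (v : Fin n → ∣ P ∣ ⊎ ∣ Q ∣ → Bool) → Fin n →
      Σ[ k ∈ ℕ ] Σ[ T ∈ (Fin k → ∣ P ∣ ⊎ ∣ Q ∣ → Bool) ]
        (∀ i → ∃[ j ] (∀ y → v i y ≡ T j y)) × (∀ j → ∃[ i ] (∀ y → v i y ≡ T j y)) ×
        (∀ j x → ∃[ i ] decode P Q R i ≡ inj₂ ((k , T , j) , x))

-- Separation of variables, derived from any cluster semantics.

module Separation {t ℓ f c} {L : Logic t ℓ f c} (S : ClusterSemantics L) where

  open Logic L
  open ClusterSemantics S

  sat-cong : {W : Set} {X : Set ℓ} {V V′ : W → X → Set ℓ} → (∀ w → V w ≈ V′ w) →
    ∀ {w} (φ : Form X) → Sat V w φ ⇔ Sat V′ w φ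
  sat-cong e {w} = sat-bisim (λ u → u , e u) (λ u → u , e u) (e w)

  sat-subst : {W : Set} {X Y : Set ℓ} {V : W → Y → Set ℓ} {V′ : W → X → Set ℓ} {w : W}
    (φ : Form X) {σ : X → Form Y} → (∀ u x → Sat V u (σ x) ⇔ V′ u x) →
    Sat V w (φ [ σ ]) ⇔ Sat V′ w φ
  sat-subst φ {σ} e = sat-[] φ σ ⨾ sat-cong e φ

  -- With total relations on both sides, the graph of a surjection that preserves valuations is a
  -- bisimulation.
  sat-surjection : {W W′ : Set} {X : Set ℓ} {V : W → X → Set ℓ} {V′ : W′ → X → Set ℓ}
    (g : W′ → W) → (∀ w → ∃[ d ] g d ≡ w) → (∀ d → V′ d ≈ V (g d)) →
    ∀ d φ → Sat V′ d φ ⇔ Sat V (g d) φ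
  sat-surjection {V = V} {V′} g onto e d =
    sat-bisim (λ d → g d , e d)
              (λ w → let (d , gd≡w) = onto w in d , subst (λ u → V′ d ≈ V u) gd≡w (e d)) (e d)

  literal : {X : Set ℓ} → Bool → X → Form X
  literal true  x = var x
  literal false x = ¬ᶠ var x

  sat-literal : {W : Set} {X : Set ℓ} (v : W → X → Bool) (w : W) (b : Bool) (x : X) →
    Sat ⟦ v ⟧ w (literal b x) ⇔ v w x ≡ b
  sat-literal v w true  x = sat-var ⨾ mk⇔ lower lift
  sat-literal v w false x = sat-¬ v w (var x) ⨾ mk⇔
    (λ n → ¬-not λ eq → n (from sat-var (lift eq)))
    (λ eq s → not-¬ eq (lower (to sat-var s)))

  constant : {X : Set ℓ} → Bool → Form X
  constant true  = ¬ᶠ ⋁ᶠ 0 λ ()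
  constant false = ⋁ᶠ 0 λ ()

  sat-constant : {W : Set} {X : Set ℓ} (v : W → X → Bool) (w : W) (b : Bool) →
    Sat ⟦ v ⟧ w (constant b) ⇔ Lift ℓ (b ≡ true)
  sat-constant v w false = sat-⋁ v w 0 _ ⨾ mk⇔ (λ n → contradiction (λ ()) n) λ { (lift ()) }
  sat-constant v w true  = sat-¬ v w _ ⨾
    mk⇔ (λ _ → lift refl) (λ _ s → to (sat-⋁ v w 0 _) s λ ())

  module _ {P Q R : Tuple} (β : Form (∣ P ∣ ⊎ ∣ Q ∣)) (γ : Form ((∣ P ∣ ⊎ ∣ Q ∣) ⊎ ∣ R ∣))
           (ξ : ∣ R ∣ → Form (((∣ P ∣ ⊎ ∣ Q ∣) ⊎ ∣ Q ∣) ⊎ ∣ R ∣)) where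

    infixr 5 _,ᵐ_
    _,ᵐ_ : ∀ {a} {W : Set} {X Y : Set ℓ} {A : Set a} → (W → X → A) → (W → Y → A) → W → X ⊎ Y → A
    (p ,ᵐ q) w = [ p w , q w ]′

    -- Local transition terms evaluated on a cluster.

    module _ {W : Set} where

      Β : (W → ∣ P ∣ → Bool) → (W → ∣ Q ∣ → Bool) → W → Set ℓ
      Β p q w = Sat ⟦ p ,ᵐ q ⟧ w β

      Γ : (W → ∣ P ∣ → Bool) → (W → ∣ Q ∣ → Bool) → (W → ∣ R ∣ → Bool) → W → Set ℓ
      Γ p q r w = Sat ⟦ (p ,ᵐ q) ,ᵐ r ⟧ w γ

      -- The argument for r̄ is `Set`-valued because the cocycle condition nests transition terms,
      -- and the inner values need not be Boolean.
      Ξ : (W → ∣ P ∣ → Bool) → (W → ∣ Q ∣ → Bool) → (W → ∣ Q ∣ → Bool) → (W → ∣ R ∣ → Set ℓ) →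
          W → ∣ R ∣ → Set ℓ
      Ξ p q q′ r w x = Sat (((⟦ p ⟧ ,ᵐ ⟦ q ⟧) ,ᵐ ⟦ q′ ⟧) ,ᵐ r) w (ξ x)

      Ξ-⟦⟧ : ∀ {p q q′ r} w x → Sat ⟦ ((p ,ᵐ q) ,ᵐ q′) ,ᵐ r ⟧ w (ξ x) ⇔ Ξ p q q′ ⟦ r ⟧ w x
      Ξ-⟦⟧ w x = sat-cong
        (λ { _ (inj₁ (inj₁ (inj₁ _))) → ⇔-id _ ; _ (inj₁ (inj₁ (inj₂ _))) → ⇔-id _
           ; _ (inj₁ (inj₂ _)) → ⇔-id _ ; _ (inj₂ _) → ⇔-id _ }) (ξ x)

      sat-ξ : {X : Set ℓ} {V : W → X → Set ℓ} {w : W} {f : ∣ P ∣ → X} {g g′ : ∣ Q ∣ → X}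
        {σ : ∣ R ∣ → Form X} {r : W → ∣ R ∣ → Set ℓ} → ∀ x → (∀ u y → Sat V u (σ y) ⇔ r u y) →
        Sat V w (ξ x [ [ [ [ var ∘ f , var ∘ g ]′ , var ∘ g′ ]′ , σ ]′ ]) ⇔
        Sat (λ u → [ [ [ V u ∘ f , V u ∘ g ]′ , V u ∘ g′ ]′ , r u ]′) w (ξ x)
      sat-ξ x e = sat-subst (ξ x)
        λ { _ (inj₁ (inj₁ (inj₁ _))) → sat-var ; _ (inj₁ (inj₁ (inj₂ _))) → sat-var
          ; _ (inj₁ (inj₂ _)) → sat-var ; u (inj₂ y) → e u y }

      Ξ-cong : ∀ {p q q′ r r′} → (∀ w → r w ≈ r′ w) → ∀ w → Ξ p q q′ r w ≈ Ξ p q q′ r′ w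
      Ξ-cong e w x = sat-cong
        (λ { u (inj₁ (inj₁ (inj₁ _))) → ⇔-id _ ; u (inj₁ (inj₁ (inj₂ _))) → ⇔-id _
           ; u (inj₁ (inj₂ _)) → ⇔-id _ ; u (inj₂ y) → e u y }) (ξ x)

    module _ {n : ℕ} where

      Γ⇒Β : Ext L ∣ R ∣ β γ → ∀ {p q r} → (∀ i → Γ {Fin n} p q r i) → ∀ i → Β p q i
      Γ⇒Β ext Γpqr i = to (sat-subst β λ _ _ → sat-var) (sound ext _ Γpqr i)

      module _ (ltt : LocalTransitionTerms L {P} {Q} {R} β γ ξ) where
        open LocalTransitionTerms ltt

        Ξ-identity : ∀ {p q r} → (∀ i → Γ {Fin n} p q r i) → ∀ i → Ξ p q q ⟦ r ⟧ i ≈ ⟦ r ⟧ i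
        Ξ-identity {p} {q} {r} Γpqr i x = ⇔-sym
          (⇔-sym sat-var ⨾ to (sat-↔ v i _ _) (sound (identity x) v Γpqr i) ⨾ sat-ξ x (λ _ _ → sat-var))
          where v = (p ,ᵐ q) ,ᵐ r

        Ξ-cocycle : ∀ {p q₁ q₂ q₃ r} →
          (∀ i → Γ {Fin n} p q₁ r i) → (∀ i → Β p q₂ i) → (∀ i → Β p q₃ i) →
          ∀ i → Ξ p q₁ q₃ ⟦ r ⟧ i ≈ Ξ p q₂ q₃ (Ξ p q₁ q₂ ⟦ r ⟧) i
        Ξ-cocycle {p} {q₁} {q₂} {q₃} {r} Γ₁ Β₂ Β₃ i x =
          ⇔-sym (sat-ξ x λ _ _ → sat-var)
          ⨾ to (sat-↔ v i _ _) (sound (cocycle x) v hyps i)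
          ⨾ sat-ξ x (λ _ y → sat-ξ y λ _ _ → sat-var)
          where
          v = (((p ,ᵐ q₁) ,ᵐ q₂) ,ᵐ q₃) ,ᵐ r
          hyps : ∀ i → Sat ⟦ v ⟧ i _
          hyps i = from (sat-∧ v i _ _)
            ( from (sat-subst γ λ { _ (inj₁ (inj₁ _)) → sat-var ; _ (inj₁ (inj₂ _)) → sat-var
                                  ; _ (inj₂ _) → sat-var }) (Γ₁ i)
            , from (sat-∧ v i _ _)
              ( from (sat-subst β λ { _ (inj₁ _) → sat-var ; _ (inj₂ _) → sat-var }) (Β₂ i)
              , from (sat-subst β λ { _ (inj₁ _) → sat-var ; _ (inj₂ _) → sat-var }) (Β₃ i)))

        -- q₃ plays the role of the interpretation q′ of q̄ coming from T.
        module _ {p q₁ q₂ q₃ r₁ r₂} (ext : Ext L ∣ R ∣ β γ) (Γ₁ : ∀ i → Γ {Fin n} p q₁ r₁ i)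
                 (Γ₂ : ∀ i → Γ p q₂ r₂ i) (Β₃ : ∀ i → Β p q₃ i) where

          -- The cocycle condition routes the transition from `q₁` to `q₃` through `q₂`, where `rel`
          -- replaces the intermediate value by `r₂`.
          related⇒agree : (∀ i → Ξ p q₁ q₂ ⟦ r₁ ⟧ i ≈ ⟦ r₂ ⟧ i) →
            ∀ i → Ξ p q₁ q₃ ⟦ r₁ ⟧ i ≈ Ξ p q₂ q₃ ⟦ r₂ ⟧ i
          related⇒agree rel i x =
            Ξ-cocycle Γ₁ (Γ⇒Β ext Γ₂) Β₃ i x ⨾ Ξ-cong rel i x

          agree⇒related : (∀ i → Ξ p q₁ q₃ ⟦ r₁ ⟧ i ≈ Ξ p q₂ q₃ ⟦ r₂ ⟧ i) →
            ∀ i → Ξ p q₁ q₂ ⟦ r₁ ⟧ i ≈ ⟦ r₂ ⟧ i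
          agree⇒related agree i x =
            Ξ-cocycle Γ₁ Β₃ Β₂ i x ⨾ Ξ-cong agree i x ⨾ ⇔-sym (Ξ-cocycle Γ₂ Β₃ Β₂ i x)
            ⨾ Ξ-identity Γ₂ i x
            where Β₂ = Γ⇒Β ext Γ₂

    -- Fibre products over p̄-types.

    Matches : {W : Set} {k : ℕ} → (W → ∣ P ∣ → Bool) → (Fin k → ∣ P ∣ ⊎ ∣ Q ∣ → Bool) →
              W → Fin k → Set ℓ
    Matches p T w j = ∀ x → p w x ≡ T j (inj₁ x)

    -- The points are presented by an enumeration because `sound` speaks of models on some `Fin n`.
    -- Repetitions are allowed; they do not affect satisfaction.
    record FibreProduct {n k : ℕ} (p : Fin n → ∣ P ∣ → Bool)
                        (T : Fin k → ∣ P ∣ ⊎ ∣ Q ∣ → Bool) : Set ℓ where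
      field
        size     : ℕ
        π₁       : Fin size → Fin n
        π₂       : Fin size → Fin k
        matches  : ∀ d → Matches p T (π₁ d) (π₂ d)
        exhausts : ∀ i j → Matches p T i j → ∃[ d ] (π₁ d , π₂ d) ≡ (i , j)

    -- Classical only because the infinitely many variables of S5∞ may make
    -- Matches undecidable.
    fibreProduct : ∀ {n k} (p : Fin n → ∣ P ∣ → Bool) (T : Fin k → ∣ P ∣ ⊎ ∣ Q ∣ → Bool) →
      ¬ ¬ FibreProduct p T
    fibreProduct {n} {k} p T =
      ¬¬-map build (¬¬-Π λ i → ¬¬-Π λ j → ¬¬-excluded-middle)
      where
      build : (∀ i j → Dec (Matches p T i j)) → FibreProduct p T
      build matches? = record
        { size = m ; π₁ = proj₁ ∘ e ; π₂ = proj₂ ∘ e ; matches = e-matches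
        ; exhausts = λ i j → e-exhausts (i , j) }
        where
        enumeration = enumerateSubset {P = λ (i , j) → Matches p T i j}
          (cartesianProduct (allFin n) (allFin k))
          (λ (i , j) → ∈-cartesianProduct⁺ (∈-allFin i) (∈-allFin j))
          (λ (i , j) → matches? i j)
        m          = proj₁ enumeration
        e          = proj₁ (proj₂ enumeration)
        e-matches  = proj₁ (proj₂ (proj₂ enumeration))
        e-exhausts = proj₂ (proj₂ (proj₂ enumeration))

    -- The separating formulas and their truth on the fibre product.

    module _ {k : ℕ} (T : Fin k → ∣ P ∣ ⊎ ∣ Q ∣ → Bool) where

      matching : Fin k → Form ((∣ P ∣ ⊎ ∣ Q ∣) ⊎ ∣ R ∣)
      matching j = ⋀ P λ x → literal (T j (inj₁ x)) (inj₁ (inj₁ x))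

      -- At the pair (i , j), the second copy of q̄ takes its value from `T`, which is a truth
      -- constant once j is fixed; all other variables are read at i.
      assign : Fin k → ((∣ P ∣ ⊎ ∣ Q ∣) ⊎ ∣ Q ∣) ⊎ ∣ R ∣ → Form ((∣ P ∣ ⊎ ∣ Q ∣) ⊎ ∣ R ∣)
      assign j (inj₁ (inj₁ y)) = var (inj₁ y)
      assign j (inj₁ (inj₂ y)) = constant (T j (inj₂ y))
      assign j (inj₂ y)        = var (inj₂ y)

      β′ : Form (((∣ P ∣ ⊎ ∣ Q ∣) ⊎ ∣ Q ∣) ⊎ ∣ R ∣)
      β′ = β [ [ var ∘ inj₁ ∘ inj₁ ∘ inj₁ , var ∘ inj₁ ∘ inj₂ ]′ ]

      relativized : (j : Fin k) → Form (((∣ P ∣ ⊎ ∣ Q ∣) ⊎ ∣ Q ∣) ⊎ ∣ R ∣) →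
                    Form ((∣ P ∣ ⊎ ∣ Q ∣) ⊎ ∣ R ∣)
      relativized j φ = relativize matching assign φ j

      -- The guards make C ×ₚ T → C surjective and (p, q′) a model of β, which is
      -- what the cocycle condition needs.
      transition : Fin k → ∣ R ∣ → Form ((∣ P ∣ ⊎ ∣ Q ∣) ⊎ ∣ R ∣)
      transition j x = (□ᶠ (⋁ᶠ k matching) ∧ matching j) ∧ relativized j (□ᶠ β′ ∧ ξ x)

      module _ {n : ℕ} {p : Fin n → ∣ P ∣ → Bool} {q : Fin n → ∣ Q ∣ → Bool}
               {r : Fin n → ∣ R ∣ → Bool} where

        private
          v : Fin n → (∣ P ∣ ⊎ ∣ Q ∣) ⊎ ∣ R ∣ → Bool
          v = (p ,ᵐ q) ,ᵐ r

        sat-matching : ∀ i j → Sat ⟦ v ⟧ i (matching j) ⇔ Matches p T i j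
        sat-matching i j = sat-⋀ v i P _ ⨾ Π-⇔ λ x → sat-literal v i (T j (inj₁ x)) (inj₁ (inj₁ x))

        sat-transition : ∀ i j x → Sat ⟦ v ⟧ i (transition j x) ⇔
          (((∀ i → ¬ (∀ j → ¬ Matches p T i j)) × Matches p T i j)
            × Sat ⟦ v ⟧ i (relativized j (□ᶠ β′ ∧ ξ x)))
        sat-transition i j x = sat-∧ v i _ _ ⨾
          ((sat-∧ v i _ _ ⨾
            ((sat-□ v i _ ⨾ Π-⇔ λ u → sat-⋁ v u k matching ⨾
               →-⇔ (Π-⇔ λ j → →-⇔ (sat-matching u j) (⇔-id _)) (⇔-id _))
             ×-⇔ sat-matching i j))
           ×-⇔ ⇔-id _)

        module _ (D : FibreProduct p T) where
          open FibreProduct D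

          -- Relativisation moves the evaluation to the fibre product, where `assign` amounts to the
          -- Boolean valuation `u`. Only after this change of valuation do the laws for ∧ and □
          -- apply.
          sat-relativized : ∀ d x → Sat ⟦ v ⟧ (π₁ d) (relativized (π₂ d) (□ᶠ β′ ∧ ξ x)) ⇔
            ((∀ e → Β (p ∘ π₁) (λ e → T (π₂ e) ∘ inj₂) e)
              × Ξ (p ∘ π₁) (q ∘ π₁) (λ e → T (π₂ e) ∘ inj₂) ⟦ r ∘ π₁ ⟧ d x)
          sat-relativized d x =
            sat-relativize v matching assign π₁ π₂ (λ e → from (sat-matching _ _) (matches e))
              (λ i j s → exhausts i j (to (sat-matching i j) s)) (□ᶠ β′ ∧ ξ x) d
            ⨾ sat-cong assign-sat (□ᶠ β′ ∧ ξ x)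
            ⨾ sat-∧ u d _ _
            ⨾ ((sat-□ u d _ ⨾ Π-⇔ λ e → sat-subst β λ { _ (inj₁ _) → sat-var ; _ (inj₂ _) → sat-var })
               ×-⇔ Ξ-⟦⟧ d x)
            where
            u : Fin size → ((∣ P ∣ ⊎ ∣ Q ∣) ⊎ ∣ Q ∣) ⊎ ∣ R ∣ → Bool
            u = (((p ∘ π₁) ,ᵐ (q ∘ π₁)) ,ᵐ (λ e → T (π₂ e) ∘ inj₂)) ,ᵐ (r ∘ π₁)
            assign-sat : ∀ e → (λ y → Sat ⟦ v ⟧ (π₁ e) (assign (π₂ e) y)) ≈ ⟦ u ⟧ e
            assign-sat e (inj₁ (inj₁ (inj₁ y))) = sat-var
            assign-sat e (inj₁ (inj₁ (inj₂ y))) = sat-var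
            assign-sat e (inj₁ (inj₂ y)) = sat-constant v (π₁ e) (T (π₂ e) (inj₂ y))
            assign-sat e (inj₂ y) = sat-var

    separator : ∣ Index P Q R ∣ → Form ((∣ P ∣ ⊎ ∣ Q ∣) ⊎ ∣ R ∣)
    separator i = [ var ∘ inj₁ ∘ inj₁ , (λ ((_ , T , j) , x) → transition T j x) ]′ (decode P Q R i)

    -- Relatedness and agreement on the separating formulas.

    module _ (ext : Ext L ∣ R ∣ β γ) (ltt : LocalTransitionTerms L {P} {Q} {R} β γ ξ)
             {n : ℕ} {p : Fin n → ∣ P ∣ → Bool} where

      module _ {k : ℕ} {T : Fin k → ∣ P ∣ ⊎ ∣ Q ∣ → Bool} (D : FibreProduct p T) where
        open FibreProduct D

        module _ (onto : ∀ i → ∃[ d ] π₁ d ≡ i) where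

          Γ-π₁ : ∀ {q r} → (∀ i → Γ p q r i) → ∀ d → Γ (p ∘ π₁) (q ∘ π₁) (r ∘ π₁) d
          Γ-π₁ Γpqr d = from (sat-surjection π₁ onto
            (λ { _ (inj₁ (inj₁ _)) → ⇔-id _ ; _ (inj₁ (inj₂ _)) → ⇔-id _ ; _ (inj₂ _) → ⇔-id _ }) d γ)
            (Γpqr (π₁ d))

          Ξ-π₁ : ∀ {q q′ r} d → Ξ (p ∘ π₁) (q ∘ π₁) (q′ ∘ π₁) ⟦ r ∘ π₁ ⟧ d ≈ Ξ p q q′ ⟦ r ⟧ (π₁ d)
          Ξ-π₁ d x = sat-surjection π₁ onto
            (λ { _ (inj₁ (inj₁ (inj₁ _))) → ⇔-id _ ; _ (inj₁ (inj₁ (inj₂ _))) → ⇔-id _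
               ; _ (inj₁ (inj₂ _)) → ⇔-id _ ; _ (inj₂ _) → ⇔-id _ }) d (ξ x)

      Agree : (q₁ q₂ : Fin n → ∣ Q ∣ → Bool) (r₁ r₂ : Fin n → ∣ R ∣ → Bool) →
              Form ((∣ P ∣ ⊎ ∣ Q ∣) ⊎ ∣ R ∣) → Set ℓ
      Agree q₁ q₂ r₁ r₂ φ = ∀ i → Sat ⟦ (p ,ᵐ q₁) ,ᵐ r₁ ⟧ i φ ⇔ Sat ⟦ (p ,ᵐ q₂) ,ᵐ r₂ ⟧ i φ

      module _ {q₁ q₂ r₁ r₂} (Γ₁ : ∀ i → Γ p q₁ r₁ i) (Γ₂ : ∀ i → Γ p q₂ r₂ i) where

        -- The guards depend on `p` and `T` alone, so they are shared by both models. Where they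
        -- hold, `π₁` is onto, both models and their relatedness pull back to the fibre product, and
        -- `related⇒agree` applies there. The fibre product exists only up to double negation, which
        -- `sat-stable` removes.
        related⇒transitions-agree : (∀ i → Ξ p q₁ q₂ ⟦ r₁ ⟧ i ≈ ⟦ r₂ ⟧ i) →
          ∀ {k} (T : Fin k → ∣ P ∣ ⊎ ∣ Q ∣ → Bool) j x → Agree q₁ q₂ r₁ r₂ (transition T j x)
        related⇒transitions-agree related T j x i = mk⇔
          (λ s → sat-stable _ i _ (¬¬-map (λ e → to   e s) (equiv (guard s))))
          (λ s → sat-stable _ i _ (¬¬-map (λ e → from e s) (equiv (guard s))))
          where
          guard : ∀ {q r} → Sat ⟦ (p ,ᵐ q) ,ᵐ r ⟧ i (transition T j x) →
                  (∀ i → ¬ (∀ j → ¬ Matches p T i j)) × Matches p T i j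
          guard s = proj₁ (to (sat-transition T i j x) s)
          equiv : (∀ i → ¬ (∀ j → ¬ Matches p T i j)) × Matches p T i j →
                  ¬ ¬ (Sat ⟦ (p ,ᵐ q₁) ,ᵐ r₁ ⟧ i (transition T j x) ⇔
                       Sat ⟦ (p ,ᵐ q₂) ,ᵐ r₂ ⟧ i (transition T j x))
          equiv (covered , m) no-equiv = fibreProduct p T λ D → ¬¬-Π
            -- The disjunction in the guard only denies that no j matches i, so each point has a
            -- preimage under `π₁` up to double negation; `¬¬-Π` collects these.
            (λ i ne → covered i λ j m →
              let (d , e) = FibreProduct.exhausts D i j m in ne (d , cong proj₁ e))
            (λ onto → no-equiv
              (sat-transition T i j x ⨾ (⇔-id _ ×-⇔ on-fibre D onto) ⨾ ⇔-sym (sat-transition T i j x)))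
            where
            on-fibre : (D : FibreProduct p T) → (∀ i → ∃[ d ] FibreProduct.π₁ D d ≡ i) →
                       Sat ⟦ (p ,ᵐ q₁) ,ᵐ r₁ ⟧ i (relativized T j (□ᶠ (β′ T) ∧ ξ x)) ⇔
                       Sat ⟦ (p ,ᵐ q₂) ,ᵐ r₂ ⟧ i (relativized T j (□ᶠ (β′ T) ∧ ξ x))
            on-fibre D onto with FibreProduct.exhausts D i j m
            ... | d , refl = sat-relativized T D d x ⨾ mk⇔
                (λ (Β₃ , s) → Β₃ , to   (agree Β₃) s)
                (λ (Β₃ , s) → Β₃ , from (agree Β₃) s) ⨾ ⇔-sym (sat-relativized T D d x)
              where
              agree = λ Β₃ → related⇒agree ltt ext (Γ-π₁ D onto Γ₁) (Γ-π₁ D onto Γ₂) Β₃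
                (λ e y → Ξ-π₁ D onto e y ⨾ related (FibreProduct.π₁ D e) y) d x

        -- `decode-model` supplies a coded copy `T` of the model (`p`, `q₁`), the point `i` showing
        -- that the cluster is nonempty. All guards hold for this `T`, so `agree⇒related` applies on
        -- the fibre product. Both sides of the conclusion are ¬¬-stable, so a doubly negated fibre
        -- product suffices.
        separators-agree⇒related : (∀ s → Agree q₁ q₂ r₁ r₂ (separator s)) →
          ∀ i → Ξ p q₁ q₂ ⟦ r₁ ⟧ i ≈ ⟦ r₂ ⟧ i
        separators-agree⇒related agree i x with decode-model P Q R (p ,ᵐ q₁) i
        ... | k , T , T-covers , T-occurs , T-coded = mk⇔
          (λ s → lift (Bool-stable λ ne → fibreProduct p T λ D → ne (lower (to (on-fibre D) s))))
          (λ s → Ξ-stable λ ne → fibreProduct p T λ D → ne (from (on-fibre D) s))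
          where
          Bool-stable : Stable (r₂ i x ≡ true)
          Bool-stable = decidable-stable (r₂ i x Bool.≟ true)
          Ξ-stable : Stable (Ξ p q₁ q₂ ⟦ r₁ ⟧ i x)
          Ξ-stable nn = to (Ξ-⟦⟧ i x)
            (sat-stable (((p ,ᵐ q₁) ,ᵐ q₂) ,ᵐ r₁) i (ξ x) (¬¬-map (from (Ξ-⟦⟧ i x)) nn))
          match : ∀ i → Matches p T i (proj₁ (T-covers i))
          match i y = proj₂ (T-covers i) (inj₁ y)
          transition-agree : ∀ j x → Agree q₁ q₂ r₁ r₂ (transition T j x)
          transition-agree j x with T-coded j x
          ... | s , decode≡ with agree s
          ... | a rewrite decode≡ = a
          on-fibre : FibreProduct p T → Ξ p q₁ q₂ ⟦ r₁ ⟧ i x ⇔ ⟦ r₂ ⟧ i x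
          on-fibre D = subst (λ i → Ξ p q₁ q₂ ⟦ r₁ ⟧ i x ⇔ ⟦ r₂ ⟧ i x) (proj₂ (onto i))
            (⇔-sym (Ξ-π₁ D onto d₀ x)
             ⨾ agree⇒related ltt ext (Γ-π₁ D onto Γ₁) (Γ-π₁ D onto Γ₂) Β₃ Ξ-agree d₀ x)
            where
            open FibreProduct D
            onto : ∀ i → ∃[ d ] π₁ d ≡ i
            onto i = let (d , e) = exhausts i _ (match i) in d , cong proj₁ e
            d₀ = proj₁ (onto i)
            -- The fibre product with q̄ read in `T` realises exactly the types of (`p`, `q₁`), so
            -- the two models are bisimilar and β transfers.
            Β₃ : ∀ d → Β (p ∘ π₁) (λ e → T (π₂ e) ∘ inj₂) d
            Β₃ d = let (i , i≡) = T-occurs (π₂ d) in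
              to (sat-bisim fibre-covers fibre-occurs (type-≡ {d = d} i≡) β) (Γ⇒Β ext Γ₁ i)
              where
              type-≡ : ∀ {i d} → (∀ y → (p ,ᵐ q₁) i y ≡ T (π₂ d) y) →
                ⟦ p ,ᵐ q₁ ⟧ i ≈ ⟦ (p ∘ π₁) ,ᵐ (λ e → T (π₂ e) ∘ inj₂) ⟧ d
              type-≡ {d = d} i≡ = ⟦⟧-≡ λ { (inj₁ y) → trans (i≡ (inj₁ y)) (sym (matches d y))
                                         ; (inj₂ y) → i≡ (inj₂ y) }
              fibre-covers : ∀ i → ∃[ d ] ⟦ p ,ᵐ q₁ ⟧ i ≈ ⟦ (p ∘ π₁) ,ᵐ (λ e → T (π₂ e) ∘ inj₂) ⟧ d
              fibre-covers i = let (d , e) = exhausts i _ (match i) in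
                d , type-≡ λ y → trans (proj₂ (T-covers i) y) (cong (λ j → T j y) (sym (cong proj₂ e)))
              fibre-occurs : ∀ d → ∃[ i ] ⟦ p ,ᵐ q₁ ⟧ i ≈ ⟦ (p ∘ π₁) ,ᵐ (λ e → T (π₂ e) ∘ inj₂) ⟧ d
              fibre-occurs d = let (i , i≡) = T-occurs (π₂ d) in i , type-≡ {d = d} i≡
            Ξ-agree : ∀ d → Ξ (p ∘ π₁) (q₁ ∘ π₁) (λ e → T (π₂ e) ∘ inj₂) ⟦ r₁ ∘ π₁ ⟧ d ≈
                            Ξ (p ∘ π₁) (q₂ ∘ π₁) (λ e → T (π₂ e) ∘ inj₂) ⟦ r₂ ∘ π₁ ⟧ d
            Ξ-agree d x = mk⇔
              (λ s → proj₂ (proj₂ (to   transitions (guard , Β₃ , s))))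
              (λ s → proj₂ (proj₂ (from transitions (guard , Β₃ , s))))
              where
              -- Every point of the cluster matches its own copy in `T`, so the first guard holds.
              guard = (λ i none → none _ (match i)) , matches d
              transitions =
                (⇔-id _ ×-⇔ ⇔-sym (sat-relativized T D d x)) ⨾ ⇔-sym (sat-transition T (π₁ d) (π₂ d) x)
                ⨾ transition-agree (π₂ d) x (π₁ d)
                ⨾ sat-transition T (π₁ d) (π₂ d) x ⨾ (⇔-id _ ×-⇔ sat-relativized T D d x)

    -- Truth of the coequivalence relation and of its separated form.

    module _ {n : ℕ} (v : Fin n → Two L {P} {Q} {R} → Bool) where

      p₁ p₂ : Fin n → ∣ P ∣ → Bool
      q₁ q₂ : Fin n → ∣ Q ∣ → Bool
      r₁ r₂ : Fin n → ∣ R ∣ → Bool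
      p₁ i = v i ∘ inj₁ ∘ inj₁ ∘ inj₁
      q₁ i = v i ∘ inj₁ ∘ inj₁ ∘ inj₂
      r₁ i = v i ∘ inj₁ ∘ inj₂
      p₂ i = v i ∘ inj₂ ∘ inj₁ ∘ inj₁
      q₂ i = v i ∘ inj₂ ∘ inj₁ ∘ inj₂
      r₂ i = v i ∘ inj₂ ∘ inj₂

      sat-copy₁ : ∀ φ i → Sat ⟦ v ⟧ i (copy₁ L {P} {Q} {R} φ) ⇔ Sat ⟦ (p₁ ,ᵐ q₁) ,ᵐ r₁ ⟧ i φ
      sat-copy₁ φ i = sat-subst φ λ
        { _ (inj₁ (inj₁ _)) → sat-var ; _ (inj₁ (inj₂ _)) → sat-var ; _ (inj₂ _) → sat-var }

      -- The second copy is read with `p₁` so that both copies become models over one and the same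
      -- `p`.
      sat-copy₂ : (∀ i x → p₁ i x ≡ p₂ i x) →
        ∀ φ i → Sat ⟦ v ⟧ i (copy₂ L {P} {Q} {R} φ) ⇔ Sat ⟦ (p₁ ,ᵐ q₂) ,ᵐ r₂ ⟧ i φ
      sat-copy₂ p≡ φ i = sat-subst φ λ
        { u (inj₁ (inj₁ x)) → sat-var ⨾ ⇔-sym (⟦⟧-≡ (p≡ u) x)
        ; _ (inj₁ (inj₂ _)) → sat-var ; _ (inj₂ _) → sat-var }

      sat-ρ : ∀ i → Sat ⟦ v ⟧ i (ρ L {P} {Q} {R} γ ξ) ⇔
        (Sat ⟦ v ⟧ i (copy₁ L {P} {Q} {R} γ) × Sat ⟦ v ⟧ i (copy₂ L {P} {Q} {R} γ)
          × (∀ x → p₁ i x ≡ p₂ i x) × Ξ p₁ q₁ q₂ ⟦ r₁ ⟧ i ≈ ⟦ r₂ ⟧ i)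
      sat-ρ i = sat-∧ v i _ _ ⨾ (⇔-id _ ×-⇔ (sat-∧ v i _ _ ⨾ (⇔-id _ ×-⇔ (sat-∧ v i _ _ ⨾
        ( (sat-⋀ v i P _ ⨾ Π-⇔ λ x → sat-↔ v i _ _ ⨾ mk⇔
            (λ e → ≡true-ext (mk⇔ lift lower ⨾ ⇔-sym sat-var ⨾ e ⨾ sat-var ⨾ mk⇔ lower lift))
            (λ e → sat-var ⨾ ⟦⟧-≡ {f = λ _ → p₁ i x} (λ _ → e) x ⨾ ⇔-sym sat-var))
        ×-⇔ (sat-⋀ v i R _ ⨾ Π-⇔ λ x → sat-↔ v i _ _ ⨾
          mk⇔ (λ e → ⇔-sym (sat-ξ x λ _ _ → sat-var) ⨾ e ⨾ sat-var)
              (λ e → sat-ξ x (λ _ _ → sat-var) ⨾ e ⨾ ⇔-sym sat-var)))))))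

      separated : Form (Two L {P} {Q} {R})
      separated = copy₁ L {P} {Q} {R} γ ∧ copy₂ L {P} {Q} {R} γ
        ∧ ⋀ (Index P Q R) (λ s →
            copy₁ L {P} {Q} {R} (separator s) ↔ copy₂ L {P} {Q} {R} (separator s))

      sat-separated : ∀ i → Sat ⟦ v ⟧ i separated ⇔
        (Sat ⟦ v ⟧ i (copy₁ L {P} {Q} {R} γ) × Sat ⟦ v ⟧ i (copy₂ L {P} {Q} {R} γ)
          × (∀ s → Sat ⟦ v ⟧ i (copy₁ L {P} {Q} {R} (separator s)) ⇔
                   Sat ⟦ v ⟧ i (copy₂ L {P} {Q} {R} (separator s))))
      sat-separated i = sat-∧ v i _ _ ⨾ (⇔-id _ ×-⇔ (sat-∧ v i _ _ ⨾ (⇔-id _ ×-⇔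
        (sat-⋀ v i _ _ ⨾ Π-⇔ λ s → sat-↔ v i _ _))))

    separatesVariables : Ext L ∣ R ∣ β γ → LocalTransitionTerms L {P} {Q} {R} β γ ξ →
      SeparatesVariables L {P} {Q} {R} γ ξ
    separatesVariables ext ltt = Index P Q R , separator , complete P Q R ⇒ , complete P Q R ⇐
      where
      ⇒ : ∀ {n} v → (∀ i → Sat {Fin n} ⟦ v ⟧ i _) → ∀ i → Sat ⟦ v ⟧ i _
      ⇒ v hyps i = from (sat-separated v i)
        ( proj₁ (at i) , proj₁ (proj₂ (at i))
        , λ s → sat-copy₁ v (separator s) i ⨾ agree s i ⨾ ⇔-sym (sat-copy₂ v p≡ (separator s) i))
        where
        at = λ i → to (sat-ρ v i) (hyps i)
        p≡ = λ i → proj₁ (proj₂ (proj₂ (at i)))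
        agree : ∀ s → Agree ext ltt (q₁ v) (q₂ v) (r₁ v) (r₂ v) (separator s)
        agree s with decode P Q R s
        ... | inj₁ x = λ i → sat-var ⨾ ⇔-sym sat-var
        ... | inj₂ ((k , T , j) , x) = related⇒transitions-agree ext ltt
          (λ i → to (sat-copy₁ v γ i) (proj₁ (at i)))
          (λ i → to (sat-copy₂ v p≡ γ i) (proj₁ (proj₂ (at i))))
          (λ i → proj₂ (proj₂ (proj₂ (at i)))) T j x
      ⇐ : ∀ {n} v → (∀ i → Sat {Fin n} ⟦ v ⟧ i _) → ∀ i → Sat ⟦ v ⟧ i _
      ⇐ v hyps i = from (sat-ρ v i)
        (proj₁ (at i) , proj₁ (proj₂ (at i)) , p≡ i , separators-agree⇒related ext ltt
          (λ i → to (sat-copy₁ v γ i) (proj₁ (at i)))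
          (λ i → to (sat-copy₂ v p≡ γ i) (proj₁ (proj₂ (at i))))
          (λ s i → ⇔-sym (sat-copy₁ v (separator s) i) ⨾ proj₂ (proj₂ (at i)) s
                   ⨾ sat-copy₂ v p≡ (separator s) i)
          i)
        where
        at = λ i → to (sat-separated v i) (hyps i)
        -- The separators that are variables of p̄ give this equality; `sat-copy₂` depends on it
        -- before the other separators can be used.
        p≡ : ∀ i x → p₁ v i x ≡ p₂ v i x
        p≡ i x with decode-var P Q R x
        ... | s , decode≡ with proj₂ (proj₂ (at i)) s
        ... | e rewrite decode≡ = ≡true-ext
          (mk⇔ lift lower ⨾ ⇔-sym (sat-var ⨾ sat-var) ⨾ ⇔-sym (sat-[] _ _) ⨾ e
           ⨾ sat-[] _ _ ⨾ sat-var ⨾ sat-var ⨾ mk⇔ lower lift)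

  lcosp : LCoSP L
  lcosp {P} {Q} {R} α β _ γ ext ξ ltt = separatesVariables {P} {Q} {R} β γ ξ ext ltt

-- The finitary logic S5 on clusters.

module S5-semantics where
  open S5-logic

  Sat : {W : Set} {X : Set} → (W → X → Set) → W → Form X → Set
  Sat V w (var x) = V w x
  Sat V w ⊥′      = ⊥
  Sat V w (φ ⇒ ψ) = Sat V w φ → Sat V w ψ
  Sat V w (□ φ)   = ∀ u → Sat V u φ

  sat-bisim : {W W′ : Set} {X : Set} {V : W → X → Set} {V′ : W′ → X → Set} →
    (∀ w → ∃[ w′ ] V w ≈ V′ w′) → (∀ w′ → ∃[ w ] V w ≈ V′ w′) →
    ∀ {w w′} → V w ≈ V′ w′ → (φ : Form X) → Sat V w φ ⇔ Sat V′ w′ φ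
  sat-bisim forth back e (var x) = e x
  sat-bisim forth back e ⊥′      = ⇔-id _
  sat-bisim forth back e (φ ⇒ ψ) = →-⇔ (sat-bisim forth back e φ) (sat-bisim forth back e ψ)
  sat-bisim forth back e (□ φ)   = mk⇔
    (λ s u′ → let (u , e) = back  u′ in to   (sat-bisim forth back e φ) (s u))
    (λ s u  → let (u′ , e) = forth u in from (sat-bisim forth back e φ) (s u′))

  sat-[] : {W : Set} {X Y : Set} {V : W → Y → Set} {w : W} (φ : Form X) (σ : X → Form Y) →
    Sat V w (φ [ σ ]) ⇔ Sat (λ u x → Sat V u (σ x)) w φ
  sat-[] (var x) σ = ⇔-id _
  sat-[] ⊥′      σ = ⇔-id _
  sat-[] (φ ⇒ ψ) σ = →-⇔ (sat-[] φ σ) (sat-[] ψ σ)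
  sat-[] (□ φ)   σ = Π-⇔ λ u → sat-[] φ σ

  module _ {W X : Set} (v : W → X → Bool) where

    sat-stable : (w : W) (φ : Form X) → Stable (Sat ⟦ v ⟧ w φ)
    sat-stable w (var x) nn = lift (decidable-stable (v w x Bool.≟ true) λ n → nn (n ∘ lower))
    sat-stable w ⊥′      nn = nn id
    sat-stable w (φ ⇒ ψ) nn a = sat-stable w ψ λ n → nn λ s → n (s a)
    sat-stable w (□ φ)   nn u = sat-stable u φ λ n → nn λ s → n (s u)

    sat-∧ : (w : W) (φ ψ : Form X) → Sat ⟦ v ⟧ w (φ ∧ ψ) ⇔ (Sat ⟦ v ⟧ w φ × Sat ⟦ v ⟧ w ψ)
    sat-∧ w φ ψ = mk⇔
      (λ s → sat-stable w φ (λ n → s λ a → contradiction a n) , sat-stable w ψ (λ n → s λ _ → n))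
      (λ (a , b) s → s a b)

    sat-⋀ : (w : W) (n : ℕ) (φ : Fin n → Form X) → Sat ⟦ v ⟧ w (⋀ n φ) ⇔ (∀ i → Sat ⟦ v ⟧ w (φ i))
    sat-⋀ w zero    φ = mk⇔ (λ _ ()) (λ _ → id)
    sat-⋀ w (suc n) φ = sat-∧ w (φ zero) (⋀ n (φ ∘ suc)) ⨾ (⇔-id _ ×-⇔ sat-⋀ w n (φ ∘ suc)) ⨾
      mk⇔ (λ { (a , b) zero → a ; (a , b) (suc i) → b i }) (λ f → f zero , f ∘ suc)

    sat-axiom : ∀ {φ} → Axiom φ → ∀ w → Sat ⟦ v ⟧ w φ
    sat-axiom (ax-weak φ ψ)   w = λ a _ → a
    sat-axiom (ax-dist φ ψ χ) w = λ f g a → f a (g a)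
    sat-axiom (ax-dne φ)      w = sat-stable w φ
    sat-axiom (ax-K φ ψ)      w = λ f a u → f u (a u)
    sat-axiom (ax-T φ)        w = λ a → a w
    -- Under the total relation the truth of `□ φ` does not depend on the world, which gives both
    -- this axiom and the next.
    sat-axiom (ax-4 φ)        w = λ a _ → a
    sat-axiom (ax-5 φ)        w = λ n _ → n

    soundness : ∀ {α φ} → α ⊢ φ → (∀ w → Sat ⟦ v ⟧ w α) → ∀ w → Sat ⟦ v ⟧ w φ
    soundness hyp       valid = valid
    soundness (axiom a) valid = sat-axiom a
    soundness (mp d e)  valid w = soundness d valid w (soundness e valid w)
    soundness (nec d)   valid w = soundness d valid

  ⋁ᶠ : {X : Set} (k : ℕ) → (Fin k → Form X) → Form X
  ⋁ᶠ k φ = ¬′ ⋀ k λ j → ¬′ φ j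

  relativize : {X Y : Set} {k : ℕ} →
    (Fin k → Form X) → (Fin k → Y → Form X) → Form Y → Fin k → Form X
  relativize θ σ (var y) j = σ j y
  relativize θ σ ⊥′      j = ⊥′
  relativize θ σ (φ ⇒ ψ) j = relativize θ σ φ j ⇒ relativize θ σ ψ j
  relativize {k = k} θ σ (□ φ) j = □ (⋀ k λ j′ → θ j′ ⇒ relativize θ σ φ j′)

  sat-relativize : {W W′ : Set} {X Y : Set} {k : ℕ} (v : W → X → Bool)
    (θ : Fin k → Form X) (σ : Fin k → Y → Form X) (π₁ : W′ → W) (π₂ : W′ → Fin k) →
    (∀ d → Sat ⟦ v ⟧ (π₁ d) (θ (π₂ d))) →
    (∀ w j → Sat ⟦ v ⟧ w (θ j) → ∃[ d ] (π₁ d , π₂ d) ≡ (w , j)) →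
    (φ : Form Y) (d : W′) →
    Sat ⟦ v ⟧ (π₁ d) (relativize θ σ φ (π₂ d)) ⇔ Sat (λ e y → Sat ⟦ v ⟧ (π₁ e) (σ (π₂ e) y)) d φ
  sat-relativize {k = k} v θ σ π₁ π₂ θ-holds exhausts = go
    where
    V′ = λ e y → Sat ⟦ v ⟧ (π₁ e) (σ (π₂ e) y)
    go : ∀ φ d → Sat ⟦ v ⟧ (π₁ d) (relativize θ σ φ (π₂ d)) ⇔ Sat V′ d φ
    go (var y) d = ⇔-id _
    go ⊥′      d = ⇔-id _
    go (φ ⇒ ψ) d = →-⇔ (go φ d) (go ψ d)
    -- A box over the pairs is a box over `W` and a finite conjunction over j guarded by `θ`;
    -- `exhausts` finds the point of `W′` behind each guarded pair.
    go (□ φ)   d = (Π-⇔ λ u → sat-⋀ v u k _) ⨾ mk⇔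
      (λ s e → to (go φ e) (s (π₁ e) (π₂ e) (θ-holds e)))
      λ s u j t → at u j (exhausts u j t) s
      where
      at : ∀ u j → ∃[ d ] (π₁ d , π₂ d) ≡ (u , j) → (∀ e → Sat V′ e φ) →
           Sat ⟦ v ⟧ u (relativize θ σ φ j)
      at u j (e , refl) s = from (go φ e) (s e)

  -- Completeness of S5 for finite clusters.

  sat? : ∀ {n X} (v : Fin n → X → Bool) i φ → Dec (Sat ⟦ v ⟧ i φ)
  sat? v i (var x) = map′ lift lower (v i x Bool.≟ true)
  sat? v i ⊥′      = no id
  sat? v i (φ ⇒ ψ) = sat? v i φ →-dec sat? v i ψ
  sat? v i (□ φ)   = all? λ j → sat? v j φ

  -- Each context deciding □ ¬ χ for all complete types χ describes a finite cluster
  -- model, and together with one of its types it decides every formula.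
  module Completeness {X : Set} {n : ℕ} (enum : Fin n ≅ X) (α : Form X) where

    -- Derivations from local hypotheses Δ, to which necessitation does not apply.
    infix 2 _⊩_
    data _⊩_ (Δ : Pred (Form X) 0ℓ) : Form X → Set where
      assume  : ∀ {φ} → Δ φ → Δ ⊩ φ
      theorem : ∀ {φ} → α ⊢ φ → Δ ⊩ φ
      mp      : ∀ {φ ψ} → Δ ⊩ φ ⇒ ψ → Δ ⊩ φ → Δ ⊩ ψ

    private variable
      Δ Δ′ : Pred (Form X) 0ℓ
      φ ψ : Form X

    ∅⊩⇒⊢ : ∅ ⊩ φ → α ⊢ φ
    ∅⊩⇒⊢ (assume ())
    ∅⊩⇒⊢ (theorem d) = d
    ∅⊩⇒⊢ (mp d e)    = mp (∅⊩⇒⊢ d) (∅⊩⇒⊢ e)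

    weaken : Δ ⊆ Δ′ → Δ ⊩ φ → Δ′ ⊩ φ
    weaken Δ⊆ (assume a)  = assume (Δ⊆ a)
    weaken Δ⊆ (theorem d) = theorem d
    weaken Δ⊆ (mp d e)    = mp (weaken Δ⊆ d) (weaken Δ⊆ e)

    const : Δ ⊩ φ → Δ ⊩ ψ ⇒ φ
    const = mp (theorem (axiom (ax-weak _ _)))

    -- Holds because `nec` is confined to `theorem`: no rule boxes a local hypothesis.
    deduction : Δ ∪ ｛ ψ ｝ ⊩ φ → Δ ⊩ ψ ⇒ φ
    deduction (assume (inj₁ a))    = const (assume a)
    -- The combinator S K K; `⊥′` is an arbitrary choice for the formula discarded by the second K.
    deduction (assume (inj₂ refl)) =
      mp (mp (theorem (axiom (ax-dist _ _ _))) (theorem (axiom (ax-weak _ _))))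
         (theorem (axiom (ax-weak _ ⊥′)))
    deduction (theorem d) = const (theorem d)
    deduction (mp d e)    = mp (mp (theorem (axiom (ax-dist _ _ _))) (deduction d)) (deduction e)

    weaken₁ : Δ ⊩ φ → Δ ∪ ｛ ψ ｝ ⊩ φ
    weaken₁ = weaken inj₁

    last : Δ ∪ ｛ ψ ｝ ⊩ ψ
    last = assume (inj₂ refl)

    contrapose : Δ ∪ ｛ φ ｝ ⊩ ψ → Δ ⊩ ¬′ ψ ⇒ ¬′ φ
    contrapose d = deduction (deduction
      (mp (weaken₁ last) (mp (weaken₁ (weaken₁ (deduction d))) last)))

    exfalso : Δ ⊩ ⊥′ → Δ ⊩ φ
    exfalso d = mp (theorem (axiom (ax-dne _))) (const d)

    cases : Δ ∪ ｛ φ ｝ ⊩ ψ → Δ ∪ ｛ ¬′ φ ｝ ⊩ ψ → Δ ⊩ ψ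
    cases d e = mp (theorem (axiom (ax-dne _))) (deduction
      (mp last (mp (weaken₁ (deduction e)) (mp (weaken₁ (contrapose d)) last))))

    ∧-intro : Δ ⊩ φ → Δ ⊩ ψ → Δ ⊩ φ ∧ ψ
    ∧-intro d e = deduction (mp (mp last (weaken₁ d)) (weaken₁ e))

    ∧-elim₁ : Δ ⊩ φ ∧ ψ → Δ ⊩ φ
    ∧-elim₁ d = mp (theorem (axiom (ax-dne _))) (deduction
      (mp (weaken₁ d) (deduction (exfalso (mp (weaken₁ last) last)))))

    ∧-elim₂ : Δ ⊩ φ ∧ ψ → Δ ⊩ ψ
    ∧-elim₂ d = mp (theorem (axiom (ax-dne _))) (deduction (mp (weaken₁ d) (const last)))

    ⋀-intro : ∀ n {φ : Fin n → Form X} → (∀ i → Δ ⊩ φ i) → Δ ⊩ ⋀ n φ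
    ⋀-intro zero    d = deduction last
    ⋀-intro (suc n) d = ∧-intro (d zero) (⋀-intro n (d ∘ suc))

    ⋀-elim : ∀ n {φ : Fin n → Form X} → Δ ⊩ ⋀ n φ → ∀ i → Δ ⊩ φ i
    ⋀-elim (suc n) d zero    = ∧-elim₁ d
    ⋀-elim (suc n) d (suc i) = ⋀-elim n (∧-elim₂ d) i

    signed : Bool → Form X → Form X
    signed true  φ = φ
    signed false φ = ¬′ φ

    Signed : ∀ {n} → (Fin n → Form X) → (Fin n → Bool) → Pred (Form X) 0ℓ
    Signed {n} L s φ = ∃[ i ] signed (s i) (L i) ≡ φ

    -- Iterates `cases` along `L`. It serves twice: on the variables, to run through all complete
    -- types, and on the formulas `□ (¬′ χ t)`, to run through all cluster models.
    signed-cases : ∀ {n} (L : Fin n → Form X) → (∀ s → Δ ∪ Signed L s ⊩ φ) → Δ ⊩ φ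
    signed-cases {n = zero}  L d = weaken (λ { (inj₁ a) → a ; (inj₂ (() , _)) }) (d λ ())
    signed-cases {Δ = Δ} {φ = φ} {n = suc n} L d = cases (branch true) (branch false)
      where
      cons : Bool → (Fin n → Bool) → Fin (suc n) → Bool
      cons b s zero    = b
      cons b s (suc i) = s i
      branch : ∀ b → Δ ∪ ｛ signed b (L zero) ｝ ⊩ φ
      branch b = signed-cases (L ∘ suc) λ s → weaken
        (λ { (inj₁ a) → inj₁ (inj₁ a) ; (inj₂ (zero , e)) → inj₁ (inj₂ e)
           ; (inj₂ (suc i , e)) → inj₂ (i , e) }) (d (cons b s))

    N : ℕ
    N = 2 ^ n

    valuation : Fin N → X → Bool
    valuation t x = Inverse.to 2↔Bool (finToFun t (Inverse.from enum x))

    literal : (X → Bool) → X → Form X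
    literal v x = signed (v x) (var x)

    -- The characteristic formula of a complete type, the type being coded by its bits as a number
    -- below 2 ^ n.
    χ : Fin N → Form X
    χ t = ⋀ n λ i → literal (valuation t) (Inverse.to enum i)

    χ⇒signed : ∀ {t b x} → valuation t x ≡ b → Δ ⊩ χ t ⇒ signed b (var x)
    χ⇒signed {Δ = Δ} {t} {x = x} refl = deduction
      (subst (λ y → Δ ∪ ｛ χ t ｝ ⊩ literal (valuation t) y) (Inverse.strictlyInverseˡ enum x)
        (⋀-elim n last (Inverse.from enum x)))

    χ-cases : (∀ t → Δ ⊩ χ t ⇒ φ) → Δ ⊩ φ
    χ-cases {Δ = Δ} {φ = φ} d = signed-cases (var ∘ Inverse.to enum) λ s →
      -- The type whose bits are the signs `s`; the signed variables in the context then prove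
      -- `χ t`.
      let t = funToFin (Inverse.from 2↔Bool ∘ s)
          t≡s : ∀ i → valuation t (Inverse.to enum i) ≡ s i
          t≡s i = trans (cong (λ j → Inverse.to 2↔Bool (finToFun t j)) (Inverse.strictlyInverseʳ enum i))
                 (trans (cong (Inverse.to 2↔Bool) (finToFun-funToFin (Inverse.from 2↔Bool ∘ s) i))
                        (Inverse.strictlyInverseˡ 2↔Bool (s i)))
      in mp (weaken inj₁ (d t))
            (⋀-intro n λ i → assume
              (inj₂ (i , cong (λ b → signed b (var (Inverse.to enum i))) (sym (t≡s i)))))

    module _ (s : Fin N → Bool) where

      -- The sign `true` excludes a type, so the worlds of the described model are the types of sign
      -- `false`.
      Δₛ : Pred (Form X) 0ℓ
      Δₛ = ∅ ∪ Signed (λ t → □ (¬′ χ t)) s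

      -- The context consists of boxes and negated boxes, and axioms 4 and 5 prove the box of each
      -- of these.
      box : Δₛ ⊩ φ → Δₛ ⊩ □ φ
      box (theorem d) = theorem (nec d)
      box (mp d e)    = mp (mp (theorem (axiom (ax-K _ _))) (box d)) (box e)
      box (assume (inj₂ (t , refl))) with s t in st
      ... | true  = mp (theorem (axiom (ax-4 _))) (assume (inj₂ (t , cong (λ b → signed b _) st)))
      ... | false = mp (theorem (axiom (ax-5 _))) (assume (inj₂ (t , cong (λ b → signed b _) st)))

      excluded : ∀ {t} → s t ≡ true → Δₛ ⊩ ¬′ χ t
      excluded {t} st = mp (theorem (axiom (ax-T _))) (assume (inj₂ (t , cong (λ b → signed b _) st)))

      possible : ∀ {t} → s t ≡ false → Δₛ ⊩ ¬′ □ (¬′ χ t)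
      possible {t} st = assume (inj₂ (t , cong (λ b → signed b _) st))

      worlds = enumerateSubset {P = λ t → s t ≡ false} (allFin N) ∈-allFin (λ t → s t Bool.≟ false)
      m = proj₁ worlds
      world : Fin m → Fin N
      world = proj₁ (proj₂ worlds)
      world-possible : ∀ d → s (world d) ≡ false
      world-possible = proj₁ (proj₂ (proj₂ worlds))
      world-exhausts : ∀ t → s t ≡ false → ∃[ d ] world d ≡ t
      world-exhausts = proj₂ (proj₂ (proj₂ worlds))

      v : Fin m → X → Bool
      v = valuation ∘ world

      -- Among all complete types, the excluded ones contradict the context and the remaining ones
      -- are worlds.
      everywhere : (∀ d → Δₛ ⊩ χ (world d) ⇒ φ) → Δₛ ⊩ φ
      everywhere {φ = φ} d = χ-cases λ t → at t (s t) refl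
        where
        at : ∀ t b → s t ≡ b → Δₛ ⊩ χ t ⇒ φ
        at t true  st = deduction (exfalso (mp (weaken₁ (excluded st)) last))
        at t false st with world-exhausts t st
        ... | e , refl = d e

      -- The truth lemma. It is proved together with `falsity` because an implication needs its
      -- premise refuted in one case and proved in the other.
      truth  : ∀ φ d → Sat ⟦ v ⟧ d φ     → Δₛ ⊩ χ (world d) ⇒ φ
      falsity : ∀ φ d → ¬ (Sat ⟦ v ⟧ d φ) → Δₛ ⊩ χ (world d) ⇒ ¬′ φ

      truth (var x) d (lift vx) = χ⇒signed vx
      truth (φ ⇒ ψ) d f with sat? v d φ
      ... | yes a = deduction (const (mp (weaken₁ (truth ψ d (f a))) last))
      ... | no na = deduction (deduction (exfalso
                      (mp (mp (weaken₁ (weaken₁ (falsity φ d na))) (weaken₁ last)) last)))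
      truth (□ φ) d f = const (box (everywhere λ e → truth φ e (f e)))

      falsity (var x) d n = χ⇒signed (¬-not (n ∘ lift))
      falsity ⊥′ d n = const (deduction last)
      falsity (φ ⇒ ψ) d n = deduction (deduction
          (mp (mp (weaken₁ (weaken₁ (falsity ψ d λ b → n λ _ → b))) (weaken₁ last))
              (mp last (mp (weaken₁ (weaken₁ (truth φ d φ-holds))) (weaken₁ last)))))
        where
        φ-holds : Sat ⟦ v ⟧ d φ
        φ-holds = decidable-stable (sat? v d φ) λ na → n λ a → contradiction a na
      falsity (□ φ) d n with ¬∀⟶∃¬ m (λ e → Sat ⟦ v ⟧ e φ) (λ e → sat? v e φ) n
      -- Since φ fails at `e`, the context proves φ ⇒ ¬ χ for the type of `e`. Boxing this turns □ φ
      -- into □ ¬ χ, against the possibility of that type.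
      ... | e , ne = const (deduction (mp (weaken₁ (possible (world-possible e)))
              (mp (mp (theorem (axiom (ax-K _ _))) (weaken₁ (box (deduction (deduction
                 (mp (mp (weaken₁ (weaken₁ (falsity φ e ne))) last) (weaken₁ last))))))) last)))

    -- For each `s`, either the described model validates α, and the truth lemma yields β, or α
    -- fails at some world. In the second case the theorem α refutes the type of that world, which
    -- the context declares possible.
    completeness : ∀ {β} →
      (∀ {m} (v : Fin m → X → Bool) → (∀ i → Sat ⟦ v ⟧ i α) → ∀ i → Sat ⟦ v ⟧ i β) → α ⊢ β
    completeness {β} valid = ∅⊩⇒⊢ (signed-cases _ derive)
      where
      derive : ∀ s → Δₛ s ⊩ β
      derive s with all? (λ d → sat? (v s) d α)
      ... | yes a = everywhere s λ d → truth s β d (valid (v s) a d)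
      ... | no  n with ¬∀⟶∃¬ (m s) (λ d → Sat ⟦ v s ⟧ d α) (λ d → sat? (v s) d α) n
      ... | d , nd = exfalso (mp (possible s (world-possible s d)) (box s (deduction
              (mp (mp (weaken₁ (falsity s α d nd)) last) (theorem hyp)))))

  -- Finitely many codes for cluster models.

  codes : ℕ → ℕ
  codes n = (2 ^ n) ^ (2 ^ n)

  -- Up to bisimulation, a nonempty cluster model over n variables is a sequence
  -- of 2 ^ n complete types, possibly with repetitions.
  model-code : ∀ {n} {X : Set} (enum : Fin n ≅ X) →
    Fin (codes n) → Fin (2 ^ n) → X → Bool
  model-code enum c j x = Inverse.to 2↔Bool (finToFun (finToFun c j) (Inverse.from enum x))

  model-code-exhausts : ∀ {n m} {X : Set} (enum : Fin n ≅ X) (v : Fin m → X → Bool) → Fin m →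
    ∃[ c ] (∀ i → ∃[ j ] (∀ y → v i y ≡ model-code enum c j y))
         × (∀ j → ∃[ i ] (∀ y → v i y ≡ model-code enum c j y))
  model-code-exhausts {n} {m} {X} enum v i₀ =
    funToFin (type ∘ point) , (λ i → type i , covers i) , λ j → point j , occurs j
    where
    type : Fin m → Fin (2 ^ n)
    type i = funToFin (Inverse.from 2↔Bool ∘ v i ∘ Inverse.to enum)
    decode : Fin (2 ^ n) → X → Bool
    decode t x = Inverse.to 2↔Bool (finToFun t (Inverse.from enum x))
    decode-type : ∀ i x → v i x ≡ decode (type i) x
    decode-type i x = sym (trans
      (cong (Inverse.to 2↔Bool)
        (finToFun-funToFin (Inverse.from 2↔Bool ∘ v i ∘ Inverse.to enum) (Inverse.from enum x)))
      (trans (Inverse.strictlyInverseˡ 2↔Bool _) (cong (v i) (Inverse.strictlyInverseˡ enum x))))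
    -- A type that `v` does not realise is replaced by the type of `i₀`, so the coded sequence
    -- contains realised types only; nonemptiness enters here.
    realizer : ∀ j → Dec (∃[ i ] type i ≡ j) → Fin m
    realizer j (yes (i , _)) = i
    realizer j (no _)        = i₀
    point : Fin (2 ^ n) → Fin m
    point j = realizer j (any? λ i → type i ≟ j)
    occurs : ∀ j y → v (point j) y ≡ model-code enum (funToFin (type ∘ point)) j y
    occurs j y = trans (decode-type (point j) y)
      (cong (λ t → decode t y) (sym (finToFun-funToFin (type ∘ point) j)))
    type-point : ∀ i d → type (realizer (type i) d) ≡ type i
    type-point i (yes (_ , e)) = e
    type-point i (no n)        = contradiction (i , refl) n
    covers : ∀ i y → v i y ≡ model-code enum (funToFin (type ∘ point)) (type i) y
    covers i y = trans (decode-type i y) (cong (λ t → decode t y)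
      (sym (trans (finToFun-funToFin (type ∘ point) (type i))
                  (type-point i (any? λ i′ → type i′ ≟ type i)))))

  clusterSemantics : ClusterSemantics S5
  clusterSemantics = record
    { Sat = Sat ; sat-bisim = sat-bisim ; sat-[] = sat-[] ; sat-var = ⇔-id _
    ; ¬ᶠ_ = ¬′_ ; □ᶠ = □ ; ⋁ᶠ = ⋁ᶠ ; relativize = relativize
    ; sat-stable = sat-stable
    ; sat-¬ = λ v w φ → ⇔-id _
    ; sat-□ = λ v w φ → ⇔-id _
    ; sat-∧ = sat-∧
    ; sat-↔ = λ v w φ ψ → sat-∧ v w (φ ⇒ ψ) (ψ ⇒ φ) ⨾ mk⇔ (λ (a , b) → mk⇔ a b) (λ e → to e , from e)
    ; sat-⋀ = sat-⋀
    ; sat-⋁ = λ v w k φ → →-⇔ (sat-⋀ v w k _) (⇔-id _)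
    ; sat-relativize = sat-relativize
    ; sound = λ d v → soundness v d
    ; complete = λ P Q R → Completeness.completeness (two P Q R) _
    ; Index = λ P Q R → P + (codes (P + Q) * 2 ^ (P + Q)) * R
    ; decode = λ P Q R → decode P Q R ∘ Inverse.to (decompose P Q R)
    ; decode-var = λ P Q R x → Inverse.from (decompose P Q R) (inj₁ x)
        , cong (decode P Q R) (Inverse.strictlyInverseˡ (decompose P Q R) (inj₁ x))
    ; decode-model = λ P Q R v i₀ → let (c , covers , occurs) = model-code-exhausts +↔⊎ v i₀ in
        _ , model-code +↔⊎ c , covers , occurs , λ j x → Inverse.from (decompose P Q R) (inj₂ ((c , j) , x))
        , cong (decode P Q R) (Inverse.strictlyInverseˡ (decompose P Q R) (inj₂ ((c , j) , x)))
    }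
    where
    one : ∀ P Q R → Fin ((P + Q) + R) ≅ ((Fin P ⊎ Fin Q) ⊎ Fin R)
    one P Q R = ↔-trans +↔⊎ (+↔⊎ ⊎-↔ ↔-id _)
    two : ∀ P Q R → Fin (((P + Q) + R) + ((P + Q) + R)) ≅ Two S5 {P} {Q} {R}
    two P Q R = ↔-trans +↔⊎ (one P Q R ⊎-↔ one P Q R)
    decompose : ∀ P Q R → Fin (P + (codes (P + Q) * 2 ^ (P + Q)) * R) ≅
      (Fin P ⊎ (Fin (codes (P + Q)) × Fin (2 ^ (P + Q))) × Fin R)
    decompose P Q R = ↔-trans +↔⊎ (↔-id _ ⊎-↔ ↔-trans *↔× (*↔× ×-↔ ↔-id _))
    decode : ∀ P Q R → Fin P ⊎ (Fin (codes (P + Q)) × Fin (2 ^ (P + Q))) × Fin R →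
      Fin P ⊎ (Σ[ k ∈ ℕ ] (Fin k → Fin P ⊎ Fin Q → Bool) × Fin k) × Fin R
    decode P Q R (inj₁ x) = inj₁ x
    decode P Q R (inj₂ ((c , j) , x)) = inj₂ ((_ , model-code +↔⊎ c , j) , x)

-- The infinitary logic and locally finite frames.

module S5∞-semantics (ℓ : Level) where
  open S5∞-logic ℓ

  Sat : {W : Set} {X : Set ℓ} → (W → X → Set ℓ) → W → Form X → Set ℓ
  Sat V w (var x) = V w x
  Sat V w (¬′ φ)  = ¬ Sat V w φ
  Sat V w (□ φ)   = ∀ u → Sat V u φ
  Sat V w (⋀ I φ) = ∀ i → Sat V w (φ i)

  sat-bisim : {W W′ : Set} {X : Set ℓ} {V : W → X → Set ℓ} {V′ : W′ → X → Set ℓ} →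
    (∀ w → ∃[ w′ ] V w ≈ V′ w′) → (∀ w′ → ∃[ w ] V w ≈ V′ w′) →
    ∀ {w w′} → V w ≈ V′ w′ → (φ : Form X) → Sat V w φ ⇔ Sat V′ w′ φ
  sat-bisim forth back e (var x) = e x
  sat-bisim forth back e (¬′ φ)  = →-⇔ (sat-bisim forth back e φ) (⇔-id _)
  sat-bisim forth back e (□ φ)   = mk⇔
    (λ s u′ → let (u , e) = back  u′ in to   (sat-bisim forth back e φ) (s u))
    (λ s u  → let (u′ , e) = forth u in from (sat-bisim forth back e φ) (s u′))
  sat-bisim forth back e (⋀ I φ) = Π-⇔ λ i → sat-bisim forth back e (φ i)

  sat-[] : {W : Set} {X Y : Set ℓ} {V : W → Y → Set ℓ} {w : W} (φ : Form X) (σ : X → Form Y) →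
    Sat V w (φ [ σ ]) ⇔ Sat (λ u x → Sat V u (σ x)) w φ
  sat-[] (var x) σ = ⇔-id _
  sat-[] (¬′ φ)  σ = →-⇔ (sat-[] φ σ) (⇔-id _)
  sat-[] (□ φ)   σ = Π-⇔ λ u → sat-[] φ σ
  sat-[] (⋀ I φ) σ = Π-⇔ λ i → sat-[] (φ i) σ

  sat-stable : {W : Set} {X : Set ℓ} (v : W → X → Bool) (w : W) (φ : Form X) → Stable (Sat ⟦ v ⟧ w φ)
  sat-stable v w (var x) nn = lift (decidable-stable (v w x Bool.≟ true) λ n → nn (n ∘ lower))
  sat-stable v w (¬′ φ)  = negated-stable
  sat-stable v w (□ φ)   nn u = sat-stable v u φ λ n → nn λ s → n (s u)
  sat-stable v w (⋀ I φ) nn i = sat-stable v w (φ i) λ n → nn λ s → n (s i)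

  sat-∧ : {W : Set} {X : Set ℓ} {V : W → X → Set ℓ} {w : W} (φ ψ : Form X) →
    Sat V w (φ ∧ ψ) ⇔ (Sat V w φ × Sat V w ψ)
  sat-∧ φ ψ = mk⇔ (λ s → s (lift true) , s (lift false))
                  (λ { (a , b) (lift true) → a ; (a , b) (lift false) → b })

  implication : ∀ {a b} {A : Set a} {B : Set b} → Stable B → (¬ (A × ¬ B)) ⇔ (A → B)
  implication stable = mk⇔ (λ n a → stable λ nb → n (a , nb)) (λ f (a , nb) → nb (f a))

  ⋁ᶠ : {X : Set ℓ} (k : ℕ) → (Fin k → Form X) → Form X
  ⋁ᶠ k φ = ¬′ ⋀ (Lift ℓ (Fin k)) λ (lift j) → ¬′ φ j

  relativize : {X Y : Set ℓ} {k : ℕ} →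
    (Fin k → Form X) → (Fin k → Y → Form X) → Form Y → Fin k → Form X
  relativize θ σ (var y) j = σ j y
  relativize θ σ (¬′ φ)  j = ¬′ relativize θ σ φ j
  relativize {k = k} θ σ (□ φ) j =
    □ (⋀ (Lift ℓ (Fin k)) λ (lift j′) → ¬′ (θ j′ ∧ ¬′ relativize θ σ φ j′))
  relativize θ σ (⋀ I φ) j = ⋀ I λ i → relativize θ σ (φ i) j

  sat-relativize : {W W′ : Set} {X Y : Set ℓ} {k : ℕ} (v : W → X → Bool)
    (θ : Fin k → Form X) (σ : Fin k → Y → Form X) (π₁ : W′ → W) (π₂ : W′ → Fin k) →
    (∀ d → Sat ⟦ v ⟧ (π₁ d) (θ (π₂ d))) →
    (∀ w j → Sat ⟦ v ⟧ w (θ j) → ∃[ d ] (π₁ d , π₂ d) ≡ (w , j)) →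
    (φ : Form Y) (d : W′) →
    Sat ⟦ v ⟧ (π₁ d) (relativize θ σ φ (π₂ d)) ⇔ Sat (λ e y → Sat ⟦ v ⟧ (π₁ e) (σ (π₂ e) y)) d φ
  sat-relativize {X = X} {Y} v θ σ π₁ π₂ θ-holds exhausts = go
    where
    V′ = λ e y → Sat ⟦ v ⟧ (π₁ e) (σ (π₂ e) y)
    go : (φ : Form Y) → ∀ d → Sat ⟦ v ⟧ (π₁ d) (relativize θ σ φ (π₂ d)) ⇔ Sat V′ d φ
    go (var y) d = ⇔-id _
    go (¬′ φ)  d = →-⇔ (go φ d) (⇔-id _)
    go (⋀ I φ) d = Π-⇔ λ i → go (φ i) d
    go (□ φ)   d = (Π-⇔ λ u → Π-⇔ λ (lift j) →
      →-⇔ (sat-∧ (θ j) _) (⇔-id _) ⨾ implication (sat-stable v u (relativize θ σ φ j))) ⨾ mk⇔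
      (λ s e → to (go φ e) (s (π₁ e) (lift (π₂ e)) (θ-holds e)))
      λ s u (lift j) t → at u j (exhausts u j t) s
      where
      at : ∀ u j → ∃[ d ] (π₁ d , π₂ d) ≡ (u , j) → (∀ e → Sat V′ e φ) →
           Sat ⟦ v ⟧ u (relativize θ σ φ j)
      at u j (e , refl) s = from (go φ e) (s e)

  module _ {F : LocallyFiniteFrame} {X : Set ℓ} (V : Valuation F X) where
    open LocallyFiniteFrame F

    -- Here `g` enumerates one equivalence class, and □ never looks outside it: this is invariance
    -- under generated submodels. Both hypotheses pass from `w` to every `u`, which the box case
    -- uses.
    sat-class : {W : Set} (g : W → World) (w : W) →
      (∀ u → g w ~ g u) → (∀ z → g w ~ z → ∃[ u ] g u ≡ z) →
      (φ : Form X) → Sat ⟦ V ∘ g ⟧ w φ ⇔ (_,_⊨_ {F} V (g w) φ)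
    sat-class g w within onto (var x) = ⇔-id _
    sat-class g w within onto (¬′ φ)  = →-⇔ (sat-class g w within onto φ) (⇔-id _)
    sat-class g w within onto (⋀ I φ) = Π-⇔ λ i → sat-class g w within onto (φ i)
    sat-class g w within onto (□ φ)   = mk⇔
      (λ s z z~ → let (u , gu≡z) = onto z z~ in subst (λ z → _,_⊨_ {F} V z φ) gu≡z (to (IH u) (s u)))
      (λ s u → from (IH u) (s (g u) (within u)))
      where
      open IsEquivalence isEquivalence renaming (sym to ~-sym; trans to ~-trans; refl to ~-refl)
      IH = λ u → sat-class g u (λ u′ → ~-trans (~-sym (within u)) (within u′))
                               (λ z z~ → onto z (~-trans (within u) z~)) φ

  clusterFrame : ℕ → LocallyFiniteFrame
  clusterFrame n = record
    { World = Lift ℓ (Fin n)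
    ; _~_ = λ _ _ → ⊤
    ; isEquivalence = record { refl = tt ; sym = id ; trans = λ _ → id }
    ; locallyFinite = λ _ → List.map lift (allFin n)
                          , λ (lift i) → mk⇔ (λ _ → ∈-map⁺ lift (∈-allFin i)) (λ _ → tt)
    }

  clusterSemantics : ClusterSemantics (S5∞ ℓ)
  clusterSemantics = record
    { Sat = Sat ; sat-bisim = sat-bisim ; sat-[] = sat-[] ; sat-var = ⇔-id _
    ; ¬ᶠ_ = ¬′_ ; □ᶠ = □ ; ⋁ᶠ = ⋁ᶠ ; relativize = relativize
    ; sat-stable = sat-stable
    ; sat-¬ = λ v w φ → ⇔-id _
    ; sat-□ = λ v w φ → ⇔-id _
    ; sat-∧ = λ v w → sat-∧
    ; sat-↔ = λ v w φ ψ → sat-∧ _ _ ⨾ mk⇔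
        (λ (a , b) → mk⇔ (to (implication (sat-stable v w ψ)) (a ∘ from (sat-∧ φ (¬′ ψ))))
                         (to (implication (sat-stable v w φ)) (b ∘ from (sat-∧ ψ (¬′ φ)))))
        (λ e → from (implication (sat-stable v w ψ)) (to   e) ∘ to (sat-∧ φ (¬′ ψ))
             , from (implication (sat-stable v w φ)) (from e) ∘ to (sat-∧ ψ (¬′ φ)))
    ; sat-⋀ = λ v w I φ → ⇔-id _
    ; sat-⋁ = λ v w k φ → →-⇔ (mk⇔ (λ f j → f (lift j)) (λ f (lift j) → f j)) (⇔-id _)
    ; sat-relativize = sat-relativize
    ; sound = λ {X} {α} {β} α⊢β {n} v valid i →
        let V = λ w → v (lower w)
            sat = λ i → sat-class {clusterFrame n} V lift i (λ _ → tt) (λ z _ → lower z , refl)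
        in from (sat i β) (α⊢β (clusterFrame n) V (λ (lift i) → to (sat i α) (valid i)) (lift i))
    ; complete = λ P Q R → complete
    -- The models on all `Fin k` form a type in `Set ℓ`, so they can index the conjunction directly.
    ; Index = λ P Q R → P ⊎ (Σ[ k ∈ ℕ ] (Fin k → P ⊎ Q → Bool) × Fin k) × R
    ; decode = λ P Q R → id
    ; decode-var = λ P Q R x → inj₁ x , refl
    ; decode-model = λ P Q R v _ → _ , v , (λ i → i , λ _ → refl) , (λ i → i , λ _ → refl)
                                   , λ j x → inj₂ ((_ , v , j) , x) , refl
    }
    where
    -- Local finiteness lists the class of `w`. Pulling `V` back along `lookup` gives a finite
    -- cluster model, to which `valid` applies.
    complete : {X : Set ℓ} {α β : Form X} →
      (∀ {n} (v : Fin n → X → Bool) → (∀ i → Sat ⟦ v ⟧ i α) → ∀ i → Sat ⟦ v ⟧ i β) → α ⊢ β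
    complete {α = α} {β} valid F V Vα w = subst (λ z → _,_⊨_ {F} V z β) g-i (to (sat i β)
      (valid (V ∘ g) (λ i → from (sat i α) (Vα (g i))) i))
      where
      open LocallyFiniteFrame F
      open IsEquivalence isEquivalence renaming (sym to ~-sym; trans to ~-trans; refl to ~-refl)
      vs = proj₁ (locallyFinite w)
      class = proj₂ (locallyFinite w)
      g = lookup vs
      w∈vs = to (class w) ~-refl
      i = index w∈vs
      g-i = sym (lookup-index w∈vs)
      w~g : ∀ i → w ~ g i
      w~g i = from (class (g i)) (∈-lookup i)
      sat = λ i → sat-class V g i (λ j → ~-trans (~-sym (w~g i)) (w~g j))
        (λ z z~ → let z∈vs = to (class z) (~-trans (w~g i) z~) in index z∈vs , sym (lookup-index z∈vs))

theorem5p19 : (ℓ : Level) → LCoSP S5 × LCoSP (S5∞ ℓ)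
theorem5p19 ℓ = Separation.lcosp S5-semantics.clusterSemantics
              , Separation.lcosp (S5∞-semantics.clusterSemantics ℓ)
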